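{- Let $G$ be a graph with $n$ vertices and $M=M[IAS(G)]$. Every graph falls under precisely one of the following five cases. \begin{enumerate} \item If $n\le 3$ and $G$ is connected, then $\kappa(M)=n$. \item If $G$ is disconnected, then $\kappa(M)=1$. \item If $n\ge 4$, $G$ is connected, and $G$ is not prime, then $\kappa(M)=3$. \item If $n\ge 5$, $G$ is prime, and $\kappa(M)<n$, then $\kappa(M)$ is odd and $\kappa(M)\ge 5$. \item If $n\ge 5$ and $\kappa(M)=n$, then $G$ is locally equivalent to (a graph isomorphic to) either the cycle graph $C_5$ or the wheel graph $W_5$. \end{enumerate}
   Context: A graph is a finite looped simple graph (loops allowed, no multiple edges). "Adjacent"/"neighbor" refer only to non-loop edges; $N_G(v)=\{w\neq v\mid vw\in E(G)\}$, $n=|V(G)|$. $A(G)$ is the $GF(2)$ adjacency matrix (diagonal entry $1$ iff the vertex is looped). $M[IAS(G)]$ is the binary matroid represented by $IAS(G)=(I\;A(G)\;A(G)+I)$, with ground set $W(G)$ of $3n$ elements $\phi_G(v),\chi_G(v),\psi_G(v)$. For a matroid $M$ on $W$ with rank $r$, $\lambda(S)=r(S)+r(W-S)-r(M)$; $S$ is a vertical $k$-separation if $\lambda(S)<k$ and $r(S),r(W-S)\ge k$; $\kappa(M)=\min(\{k\mid M\text{ has a vertical }k\text{ -separation}\}\cup\{r(M)\})$. A split of $G$ is a partition $V(G)=V_1\cup V_2$ with $|V_1|,|V_2|\ge2$ and subsets $W_i\subseteq V_i$ such that every $v\in V_1$ has $N_G(v)\cap V_2=W_2$ if $v\in W_1$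 and $N_G(v)\cap V_2=\emptyset$ if $v\in V_1-W_1$; $G$ is prime if it has no split (so all graphs with at most 3 vertices are prime). Local equivalence: for $v\in V(G)$, the loop complement $G^v_\ell$ reverses the loop status of $v$; the simple local complement $G^v_s$ reverses all adjacencies between distinct elements of $N_G(v)$; the non-simple local complement $G^v_{ns}$ is obtained from $G^v_s$ by reversing loop status at every vertex of $N_G(v)$. Graphs are locally equivalent if one is obtained from the other by a sequence of these operations. $W_5$ is the wheel with 5 spokes (6 vertices). -}

module Defs where

open import Data.Bool using (Bool; true; false; _∧_; _∨_; not; _xor_; if_then_else_)
open import Data.Nat using (ℕ; zero; suc; _+_; _*_; _∸_; _≤_; _<_; _⊓_; _⊔_; _%_; _≡ᵇ_; _<ᵇ_; _≤ᵇ_)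
open import Data.Fin using (Fin; toℕ; splitAt; _≟_)
open import Data.Fin.Subset using (Subset; ∣_∣; ∁; ⊤; _∈_; _∉_; _⊆_; inside; outside)
open import Data.Vec using (Vec; []; _∷_; lookup)
open import Data.List using (List; []; _∷_; map; _++_; foldr; allFin; upTo)
open import Data.Bool.ListAction using (all; any)
open import Data.Sum using (_⊎_; inj₁; inj₂; [_,_]′)
open import Data.Product using (Σ; _×_; ∃; _,_)
open import Relation.Nullary using (¬_)
open import Relation.Nullary.Decidable using (⌊_⌋)
open import Relation.Binary.PropositionalEquality using (_≡_; _≢_)
open import Relation.Binary.Construct.Closure.ReflexiveTransitive using (Star)
open import Function.Bundles using (_↔_; Inverse)

-- Looped simple graphs on the vertex set Fin n, given by their GF(2)
-- adjacency matrix A(G) (Bool = GF(2), diagonal entry = loop).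

Graph : ℕ → Set
Graph n = Fin n → Fin n → Bool

IsGraph : ∀ {n} → Graph n → Set
IsGraph {n} G = ∀ (i j : Fin n) → G i j ≡ G j i

eqB : ∀ {n} → Fin n → Fin n → Bool
eqB i j = ⌊ i ≟ j ⌋

Adj : ∀ {n} → Graph n → Fin n → Fin n → Set
Adj G u v = (u ≢ v) × (G u v ≡ true)

data Reach {n} (G : Graph n) (u : Fin n) : Fin n → Set where
  here : Reach G u u
  step : ∀ {v w} → Reach G u v → Adj G v w → Reach G u w

Connected : ∀ {n} → Graph n → Set
Connected {n} G = ∀ (u v : Fin n) → Reach G u v

record Split {n} (G : Graph n) : Set where
  field
    V₁ W₁ W₂ : Subset n
    W₁⊆V₁    : W₁ ⊆ V₁
    W₂⊆V₂    : W₂ ⊆ ∁ V₁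
    size₁    : 2 ≤ ∣ V₁ ∣
    size₂    : 2 ≤ ∣ ∁ V₁ ∣
    nbhd-in  : ∀ v → v ∈ W₁ → ∀ w → w ∈ ∁ V₁ → (Adj G v w → w ∈ W₂) × (w ∈ W₂ → Adj G v w)
    nbhd-out : ∀ v → v ∈ V₁ → v ∉ W₁ → ∀ w → w ∈ ∁ V₁ → ¬ Adj G v w

Prime : ∀ {n} → Graph n → Set
Prime G = ¬ Split G

nbrB : ∀ {n} → Graph n → Fin n → Fin n → Bool
nbrB G v w = not (eqB w v) ∧ G v w

loopComp : ∀ {n} → Fin n → Graph n → Graph n
loopComp v G i j = G i j xor (eqB i v ∧ eqB j v)

simpleLC : ∀ {n} → Fin n → Graph n → Graph n
simpleLC v G i j = G i j xor (not (eqB i j) ∧ nbrB G v i ∧ nbrB G v j)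

nonSimpleLC : ∀ {n} → Fin n → Graph n → Graph n
nonSimpleLC v G i j = simpleLC v G i j xor (eqB i j ∧ nbrB G v i)

data LocalStep {n} : Graph n → Graph n → Set where
  ℓ-step  : ∀ v G → LocalStep G (loopComp v G)
  s-step  : ∀ v G → LocalStep G (simpleLC v G)
  ns-step : ∀ v G → LocalStep G (nonSimpleLC v G)

LocallyEquivalent : ∀ {n} → Graph n → Graph n → Set
LocallyEquivalent = Star LocalStep

Isomorphic : ∀ {n m} → Graph n → Graph m → Set
Isomorphic {n} {m} G H =
  Σ (Fin n ↔ Fin m) λ f → ∀ i j → G i j ≡ H (Inverse.to f i) (Inverse.to f j)

cyc5 : ℕ → ℕ → Bool
cyc5 a b = ((suc a % 5) ≡ᵇ b) ∨ ((suc b % 5) ≡ᵇ a)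

C5 : Graph 5
C5 i j = cyc5 (toℕ i) (toℕ j)

W5 : Graph 6
W5 i j = ((toℕ i <ᵇ 5) ∧ (toℕ j <ᵇ 5) ∧ cyc5 (toℕ i) (toℕ j))
       ∨ ((toℕ i ≡ᵇ 5) ∧ (toℕ j <ᵇ 5))
       ∨ ((toℕ i <ᵇ 5) ∧ (toℕ j ≡ᵇ 5))

-- Binary matroids given by a GF(2) matrix with columns c : Fin m → GF(2)^k

subsets : (m : ℕ) → List (Subset m)
subsets zero    = [] ∷ []
subsets (suc m) = map (inside ∷_) (subsets m) ++ map (outside ∷_) (subsets m)

subsetB : ∀ {m} → Subset m → Subset m → Bool
subsetB {m} T S = all (λ e → not (lookup T e) ∨ lookup S e) (allFin m)

nonemptyB : ∀ {m} → Subset m → Bool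
nonemptyB {m} T = any (lookup T) (allFin m)

zeroVecB : ∀ {k} → (Fin k → Bool) → Bool
zeroVecB {k} x = all (λ i → not (x i)) (allFin k)

sumCols : ∀ {m k} → (Fin m → Fin k → Bool) → Subset m → Fin k → Bool
sumCols {m} c T i = foldr (λ e acc → (lookup T e ∧ c e i) xor acc) false (allFin m)

independentB : ∀ {m k} → (Fin m → Fin k → Bool) → Subset m → Bool
independentB {m} c T =
  all (λ T' → not (subsetB T' T ∧ nonemptyB T') ∨ not (zeroVecB (sumCols c T'))) (subsets m)

rank : ∀ {m k} → (Fin m → Fin k → Bool) → Subset m → ℕ
rank {m} c S =
  foldr (λ T acc → if subsetB T S ∧ independentB c T then ∣ T ∣ ⊔ acc else acc) 0 (subsets m)

rankM : ∀ {m k} → (Fin m → Fin k → Bool) → ℕ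
rankM c = rank c ⊤

-- connectivity function λ(S) = r(S) + r(W - S) - r(M)   (nonnegative)
connλ : ∀ {m k} → (Fin m → Fin k → Bool) → Subset m → ℕ
connλ c S = rank c S + rank c (∁ S) ∸ rankM c

verticalSepB : ∀ {m k} → (Fin m → Fin k → Bool) → ℕ → Subset m → Bool
verticalSepB c j S = (connλ c S <ᵇ j) ∧ ((j ≤ᵇ rank c S) ∧ (j ≤ᵇ rank c (∁ S)))

hasVerticalSepB : ∀ {m k} → (Fin m → Fin k → Bool) → ℕ → Bool
hasVerticalSepB {m} c j = any (verticalSepB c j) (subsets m)

-- κ(M) = min ({j | M has a vertical j-separation} ∪ {r(M)}).
-- Candidates j > r(M) cannot lower the minimum, so only j ≤ r(M) are scanned.
κ : ∀ {m k} → (Fin m → Fin k → Bool) → ℕ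
κ c = foldr (λ j acc → if hasVerticalSepB c j then j ⊓ acc else acc)
            (rankM c) (upTo (suc (rankM c)))

-- IAS(G) = (I  A(G)  A(G)+I), an n × 3n matrix.  Ground set W(G) is
-- Fin (n + (n + n)): first block φ(v), second χ(v), third ψ(v).

IAS : ∀ {n} → Graph n → Fin (n + (n + n)) → Fin n → Bool
IAS {n} G e i =
  [ (λ v → eqB i v)
  , (λ e' → [ (λ v → G i v) , (λ v → G i v xor eqB i v) ]′ (splitAt n e'))
  ]′ (splitAt n e)

Odd : ℕ → Set
Odd k = ∃ λ j → k ≡ suc (2 * j)

ExactlyOneOf5 : Set → Set → Set → Set → Set → Set
ExactlyOneOf5 P₁ P₂ P₃ P₄ P₅ =
  (P₁ ⊎ P₂ ⊎ P₃ ⊎ P₄ ⊎ P₅)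
  × ¬ (P₁ × P₂) × ¬ (P₁ × P₃) × ¬ (P₁ × P₄) × ¬ (P₁ × P₅)
  × ¬ (P₂ × P₃) × ¬ (P₂ × P₄) × ¬ (P₂ × P₅)
  × ¬ (P₃ × P₄) × ¬ (P₃ × P₅)
  × ¬ (P₄ × P₅)

{-# OPTIONS --safe #-}

-- Write c(X) for the cut-rank of a vertex set X and τ(X) for the set of the elements φ(v), χ(v), ψ(v) with v ∈ X.  Then
-- r(τ(X)) = |X| + c(X), so λ(τ(X)) = 2c(X).  As φ(v) + χ(v) + ψ(v) = 0, replacing each triple of a separation S by the side
-- that contains two of its elements does not increase λ.  Hence κ = min {n, 2c(X) + 1 : c(X) < |X|, c(X) < |V − X|},
-- which gives the first four cases: c(X) = 0 is disconnectedness and c(X) ≤ 1 is a split.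
--
-- If κ = n, then every nonzero word of the additive code over GF(4) spanned by the closed neighbourhoods has weight
-- greater than n/2.  Deleting a vertex reduces even n to odd n.  Let n = 2m + 1 ≥ 7.  Each (m+1)-set is the support of a
-- unique word, and the parity of the weight is additive.  For even m the words on T − i, where |T| = m + 2, pairwise sum to
-- words of full support T, so at one coordinate they would take four distinct nonzero values in GF(4).  For odd m all words
-- are sums of words of weight m + 1 and so are even, but the word of the whole vertex set has weight n.  There remain n = 5,
-- which is settled by enumeration, and n = 6, where deleting a vertex leads back to C₅ and every degree is at least 3.

module Submission where

open import Defs
open import Data.Bool using (Bool; true; false; _∧_; _∨_; not; _xor_; if_then_else_; T)
open import Data.Bool.ListAction using (all; any)
open import Data.Bool.Properties using (∧-assoc; ∧-comm; ∧-distribʳ-xor; ∧-distribˡ-xor; ∧-identityʳ; ∧-zeroʳ; ∨-identityʳ; ∨-zeroʳ; xor-assoc; xor-comm; xor-identityʳ; xor-same; T-≡) renaming (_≟_ to _≟ᵇ_)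
open import Data.Empty using (⊥; ⊥-elim)
open import Data.Fin using (Fin; zero; suc; _≟_; _↑ˡ_; _↑ʳ_; combine; finToFun; funToFin; inject₁; join; splitAt)
open import Data.Fin.Patterns using (0F; 1F; 2F; 3F; 4F; 5F)
open import Data.Fin.Properties using (any?; finToFun-funToFin; funToFin-finToFin; join-splitAt; pigeonhole; splitAt-↑ʳ; splitAt-↑ˡ; ¬∀⟶∃¬; <⇒≢) renaming (suc-injective to Fin-suc-injective)
open import Data.Fin.Subset using (Subset; ∣_∣; ∁; ⊤; inside; outside)
import Data.List as List
open import Data.List using (List; []; _∷_; allFin; foldr; map; upTo)
open import Data.List.Membership.Propositional using (_∈_)
open import Data.List.Membership.Propositional.Properties using (∈-allFin; ∈-map⁺; ∈-upTo⁺; ∈-++⁺ʳ; ∈-++⁺ˡ)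
open import Data.List.Relation.Unary.Any using (here; there)
open import Data.Nat using (ℕ; zero; suc; _+_; _*_; _∸_; _^_; _⊓_; _⊔_; _≤_; _<_; z≤n; s≤s; _<ᵇ_; _≤ᵇ_; _≡ᵇ_)
open import Data.Nat.Properties using (*-cancelˡ-<; *-cancelˡ-≤; *-monoʳ-≤; +-cancelˡ-<; +-cancelˡ-≡; +-cancelˡ-≤; +-comm; +-identityʳ; +-mono-≤; +-monoʳ-≤; +-monoˡ-≤; +-suc; 1+n≰n; <-irrefl; <-≤-trans; <ᵇ⇒<; <⇒<ᵇ; <⇒≤; <⇒≱; ^-monoʳ-<; _≤?_; m+n∸m≡n; m+n∸n≡m; m≤m⊔n; m≤n+m; m≤n⇒m<n∨m≡n; m≤n⇒m≤1+n; m≤n⊔m; m⊓n≤m; m⊓n≤n; n≢0⇒n>0; n≤0⇒n≡0; n≮n; suc-injective; ∸-monoˡ-≤; ≡ᵇ⇒≡; ≤-<-trans; ≤-antisym; ≤-pred; ≤-refl; ≤-reflexive; ≤-trans; ≤ᵇ⇒≤; ≤⇒≤ᵇ; ≤∧≢⇒<; ≮⇒≥; ≰⇒>; ⊓-sel; ⊔-sel) renaming (_≟_ to _≟ℕ_)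
open import Data.Nat.Tactic.RingSolver using (solve-∀)
open import Data.Product using (Σ; ∃; _×_; _,_; proj₁; proj₂)
open import Data.Sum using (_⊎_; inj₁; inj₂; [_,_]′)
open import Data.Unit using (tt) renaming (⊤ to Unit)
open import Data.Vec using (Vec; []; _∷_; lookup; tabulate)
open import Data.Vec.Functional using (_++_)
open import Data.Vec.Properties using (lookup-map; lookup-replicate; lookup∘tabulate; lookup⇒[]=; []=⇒lookup)
open import Function using (_∘_; id)
open import Function.Bundles using (_↔_; mk↔ₛ′; Equivalence; Inverse)
open import Relation.Binary.Construct.Closure.ReflexiveTransitive using (ε; _◅_; _◅◅_)
open import Relation.Binary.PropositionalEquality using (_≡_; _≢_; _≗_; refl; sym; trans; cong; cong₂; subst; module ≡-Reasoning)
open import Relation.Nullary using (¬_; Dec; yes; no; _×-dec_; _→-dec_)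
open import Relation.Nullary.Decidable using (dec-false; dec-true; decidable-stable; isYes≗does; ⌊⌋-map′)

-- Rounding a separation keeps it vertical: λ(S) < k ≤ r(W - S) forces r(S) < n, and |X| + c(X) ≤
-- r(S) < |X| + |V - X| gives c(X) < |V - X|; the other bound is symmetric. Words link cut-rank to
-- weights, since the words supported in X are the kernel of the cut matrix of X. If all nonzero
-- words weigh at least m + 1, an (m+1)-set carries a nonzero word, having m + 1 unknowns against m
-- equations, and only one, because its complement has full cut-rank m and cut-rank is symmetric.
-- Parity of the weight is additive because its only nonlinear term, a quadratic form with symmetric
-- matrix, is linear over GF(2). For odd m, the even words on an (m+2)-set take every value of GF(4)
-- at each of its coordinates, so a coordinate of a heavy word can be cancelled without changing its
-- parity. Loops do not affect supports, and a local complementation changes the value at each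
-- coordinate by an invertible map; so weights are invariant under local equivalence, and the finite
-- searches may use loopless graphs up to local complementation.

true≢false : true ≢ false
true≢false ()

not-true : ∀ {b} → b ≢ true → b ≡ false
not-true {false} _ = refl
not-true {true} h = ⊥-elim (h refl)

clash : ∀ {a} {A : Set a} {b : Bool} → b ≡ true → b ≡ false → A
clash refl ()

true? : ∀ b → (b ≡ true) ⊎ (b ≡ false)
true? true = inj₁ refl
true? false = inj₂ refl

∧-split : ∀ {a b} → a ∧ b ≡ true → (a ≡ true) × (b ≡ true)
∧-split {true} {true} _ = refl , refl

∨-falseˡ : ∀ {a b} → a ∨ b ≡ false → a ≡ false
∨-falseˡ {false} _ = refl

∨-falseʳ : ∀ {a b} → a ∨ b ≡ false → b ≡ false
∨-falseʳ {false} h = h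

xor-≡ : ∀ {a b} → a xor b ≡ false → a ≡ b
xor-≡ {false} {false} _ = refl
xor-≡ {true} {true} _ = refl

not-true⇒false : ∀ {b} → not b ≡ true → b ≡ false
not-true⇒false {false} _ = refl

xor-interchange : ∀ a b c d → (a xor b) xor (c xor d) ≡ (a xor c) xor (b xor d)
xor-interchange a b c d = trans (xor-assoc a b (c xor d)) (trans (cong (a xor_) (trans (sym (xor-assoc b c d))
  (trans (cong (_xor d) (xor-comm b c)) (xor-assoc c b d)))) (sym (xor-assoc a c (b xor d))))

eqB-refl : ∀ {n} (i : Fin n) → eqB i i ≡ true
eqB-refl i = trans (isYes≗does (i ≟ i)) (dec-true (i ≟ i) refl)

eqB-≢ : ∀ {n} {i j : Fin n} → i ≢ j → eqB i j ≡ false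
eqB-≢ {i = i} {j} h = trans (isYes≗does (i ≟ j)) (dec-false (i ≟ j) h)

eqB⇒≡ : ∀ {n} {i j : Fin n} → eqB i j ≡ true → i ≡ j
eqB⇒≡ {i = i} {j} h with i ≟ j
... | yes p = p
... | no _ = clash h refl

eqB⇒≢ : ∀ {n} {i j : Fin n} → eqB i j ≡ false → i ≢ j
eqB⇒≢ {i = i} h refl = clash (eqB-refl i) h

eqB-suc : ∀ {n} (i j : Fin n) → eqB (suc i) (suc j) ≡ eqB i j
eqB-suc i j = ⌊⌋-map′ _ _ (i ≟ j)

eqB-sym : ∀ {n} (i j : Fin n) → eqB i j ≡ eqB j i
eqB-sym i j with i ≟ j
... | yes refl = sym (eqB-refl i)
... | no h = sym (eqB-≢ (h ∘ sym))

-- Sums over GF(2).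

⨁ : ∀ {n} → (Fin n → Bool) → Bool
⨁ {zero} f = false
⨁ {suc n} f = f zero xor ⨁ (f ∘ suc)

⨁-cong : ∀ {n} {f g : Fin n → Bool} → f ≗ g → ⨁ f ≡ ⨁ g
⨁-cong {zero} h = refl
⨁-cong {suc n} h = cong₂ _xor_ (h zero) (⨁-cong (h ∘ suc))

⨁-xor : ∀ {n} (f g : Fin n → Bool) → ⨁ (λ i → f i xor g i) ≡ ⨁ f xor ⨁ g
⨁-xor {zero} f g = refl
⨁-xor {suc n} f g = trans (cong ((f zero xor g zero) xor_) (⨁-xor (f ∘ suc) (g ∘ suc)))
  (xor-interchange (f zero) (g zero) _ _)

⨁-∧ˡ : ∀ {n} x (f : Fin n → Bool) → x ∧ ⨁ f ≡ ⨁ (λ i → x ∧ f i)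
⨁-∧ˡ {zero} x f = ∧-zeroʳ x
⨁-∧ˡ {suc n} x f = trans (∧-distribˡ-xor x (f zero) _) (cong ((x ∧ f zero) xor_) (⨁-∧ˡ x (f ∘ suc)))

⨁-false : ∀ {n} {f : Fin n → Bool} → (∀ i → f i ≡ false) → ⨁ f ≡ false
⨁-false {zero} h = refl
⨁-false {suc n} h = cong₂ _xor_ (h zero) (⨁-false (h ∘ suc))

⨁-swap : ∀ {m n} (f : Fin m → Fin n → Bool) → ⨁ (λ i → ⨁ (f i)) ≡ ⨁ (λ j → ⨁ (λ i → f i j))
⨁-swap {zero} {n} f = sym (⨁-false {n} (λ _ → refl))
⨁-swap {suc m} f = trans (cong (⨁ (f zero) xor_) (⨁-swap (f ∘ suc))) (sym (⨁-xor (f zero) _))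

⨁-witness : ∀ {n} {f : Fin n → Bool} → ⨁ f ≡ true → ∃ λ i → f i ≡ true
⨁-witness {suc n} {f} h with true? (f zero)
... | inj₁ p = zero , p
... | inj₂ p with ⨁-witness {n} {f ∘ suc} (trans (cong (_xor ⨁ (f ∘ suc)) (sym p)) h)
...   | i , q = suc i , q

⨁-δ : ∀ {n} (f : Fin n → Bool) i → ⨁ (λ j → eqB i j ∧ f j) ≡ f i
⨁-δ {suc n} f zero = trans (cong (f zero xor_) (⨁-false {n} (λ _ → refl))) (xor-identityʳ _)
⨁-δ f (suc i) = trans (⨁-cong (λ j → cong (_∧ f (suc j)) (eqB-suc i j))) (⨁-δ (f ∘ suc) i)

⨁-δ′ : ∀ {n} (f : Fin n → Bool) i → ⨁ (λ j → f j ∧ eqB j i) ≡ f i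
⨁-δ′ f i = trans (⨁-cong (λ j → trans (∧-comm (f j) _) (cong (_∧ f j) (eqB-sym j i)))) (⨁-δ f i)

⨁-++ : ∀ p {q} (h : Fin (p + q) → Bool) → ⨁ h ≡ ⨁ (λ i → h (i ↑ˡ q)) xor ⨁ (λ j → h (p ↑ʳ j))
⨁-++ zero h = refl
⨁-++ (suc p) h = trans (cong (h zero xor_) (⨁-++ p (h ∘ suc))) (sym (xor-assoc (h zero) _ _))

⨁-∧ʳ : ∀ {n} (f : Fin n → Bool) x → ⨁ f ∧ x ≡ ⨁ (λ i → f i ∧ x)
⨁-∧ʳ f x = trans (∧-comm _ x) (trans (⨁-∧ˡ x f) (⨁-cong (λ i → ∧-comm x (f i))))

-- Finite sets as characteristic functions, and their cardinalities.

infix 4 _⊑_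
_⊑_ : ∀ {n} → (Fin n → Bool) → (Fin n → Bool) → Set
f ⊑ g = ∀ i → f i ≡ true → g i ≡ true

bit : Bool → ℕ
bit true = 1
bit false = 0

# : ∀ {n} → (Fin n → Bool) → ℕ
# {zero} f = 0
# {suc n} f = bit (f zero) + # (f ∘ suc)

#-cong : ∀ {n} {f g : Fin n → Bool} → f ≗ g → # f ≡ # g
#-cong {zero} h = refl
#-cong {suc n} h = cong₂ _+_ (cong bit (h zero)) (#-cong (h ∘ suc))

#-mono : ∀ {n} {f g : Fin n → Bool} → f ⊑ g → # f ≤ # g
#-mono {zero} h = z≤n
#-mono {suc n} {f} {g} h with f zero in p | g zero in q
... | true | true = s≤s (#-mono (h ∘ suc))
... | true | false = clash (h zero p) q
... | false | true = m≤n⇒m≤1+n (#-mono (h ∘ suc))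
... | false | false = #-mono (h ∘ suc)

-- The device that turns a weight bound into an equality of supports: a word supported in X whose
-- weight is at least |X| covers X.
⊑-antisym-# : ∀ {n} {f g : Fin n → Bool} → f ⊑ g → # g ≤ # f → g ⊑ f
⊑-antisym-# {suc n} {f} {g} h le i gi with f zero in p | g zero in q
⊑-antisym-# {suc n} {f} {g} h le zero gi | true | _ = p
⊑-antisym-# {suc n} {f} {g} h le zero gi | false | false = clash gi q
⊑-antisym-# {suc n} {f} {g} h le i gi | false | true =
  ⊥-elim (1+n≰n (≤-trans le (#-mono (h ∘ suc))))
⊑-antisym-# {suc n} {f} {g} h le (suc i) gi | true | true =
  ⊑-antisym-# (h ∘ suc) (≤-pred le) i gi
⊑-antisym-# {suc n} {f} {g} h le (suc i) gi | true | false = clash (h zero p) q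
⊑-antisym-# {suc n} {f} {g} h le (suc i) gi | false | false =
  ⊑-antisym-# (h ∘ suc) le i gi

#-∁ : ∀ {n} (f : Fin n → Bool) → # f + # (not ∘ f) ≡ n
#-∁ {zero} f = refl
#-∁ {suc n} f with f zero
... | true = cong suc (#-∁ (f ∘ suc))
... | false = trans (+-suc _ _) (cong suc (#-∁ (f ∘ suc)))

#-all : ∀ {n} {f : Fin n → Bool} → (∀ i → f i ≡ true) → # f ≡ n
#-all {zero} h = refl
#-all {suc n} h = cong₂ _+_ (cong bit (h zero)) (#-all (h ∘ suc))

#-none : ∀ {n} {f : Fin n → Bool} → (∀ i → f i ≡ false) → # f ≡ 0
#-none {zero} h = refl
#-none {suc n} h = cong₂ _+_ (cong bit (h zero)) (#-none (h ∘ suc))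

#-witness : ∀ {n} (f : Fin n → Bool) → 1 ≤ # f → ∃ λ i → f i ≡ true
#-witness {suc n} f le with true? (f zero)
... | inj₁ p = zero , p
... | inj₂ p with #-witness (f ∘ suc) (subst (λ b → 1 ≤ bit b + # (f ∘ suc)) p le)
...   | i , q = suc i , q

#-positive : ∀ {n} (f : Fin n → Bool) i → f i ≡ true → 1 ≤ # f
#-positive f zero p rewrite p = s≤s z≤n
#-positive f (suc i) p with f zero
... | true = s≤s z≤n
... | false = #-positive (f ∘ suc) i p

infixl 6 _∖_ _∪̇_
_∖_ : ∀ {n} → (Fin n → Bool) → Fin n → (Fin n → Bool)
(f ∖ i) j = f j ∧ not (eqB j i)

_∪̇_ : ∀ {n} → (Fin n → Bool) → Fin n → (Fin n → Bool)
(f ∪̇ i) j = f j ∨ eqB j i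

∖-⊑ : ∀ {n} (f : Fin n → Bool) i → f ∖ i ⊑ f
∖-⊑ f i j h = proj₁ (∧-split h)

∖-≢ : ∀ {n} (f : Fin n → Bool) {i j} → (f ∖ i) j ≡ true → j ≢ i
∖-≢ f {i} {.i} h refl = clash (proj₂ (∧-split {f i} h)) (cong not (eqB-refl i))

∖-self : ∀ {n} (f : Fin n → Bool) i → (f ∖ i) i ≡ false
∖-self f i = trans (cong (λ b → f i ∧ not b) (eqB-refl i)) (∧-zeroʳ (f i))

∖-∈ : ∀ {n} (f : Fin n → Bool) {i j} → f j ≡ true → j ≢ i → (f ∖ i) j ≡ true
∖-∈ f h ne = cong₂ _∧_ h (cong not (eqB-≢ ne))

∪̇-∈ : ∀ {n} (f : Fin n → Bool) i → (f ∪̇ i) i ≡ true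
∪̇-∈ f i rewrite eqB-refl i with f i
... | true = refl
... | false = refl

∪̇-≢ : ∀ {n} (f : Fin n → Bool) {i j} → j ≢ i → (f ∪̇ i) j ≡ f j
∪̇-≢ f {i} {j} h rewrite eqB-≢ h with f j
... | true = refl
... | false = refl

#-∖ : ∀ {n} (f : Fin n → Bool) i → f i ≡ true → # f ≡ suc (# (f ∖ i))
#-∖ {suc n} f zero p rewrite p =
  cong suc (#-cong (λ j → sym (∧-identityʳ (f (suc j)))))
#-∖ {suc n} f (suc i) p = trans (cong (bit (f zero) +_) (#-∖ (f ∘ suc) i p))
  (trans (+-suc _ _) (cong suc (cong₂ _+_ (cong bit (sym (∧-identityʳ (f zero))))
     (#-cong (λ j → cong (λ b → f (suc j) ∧ not b) (sym (eqB-suc j i)))))))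

#-∪̇ : ∀ {n} (f : Fin n → Bool) i → f i ≡ false → # (f ∪̇ i) ≡ suc (# f)
#-∪̇ f i p = trans (#-∖ (f ∪̇ i) i (∪̇-∈ f i)) (cong suc (#-cong same))
  where
  same : ∀ j → (f ∪̇ i ∖ i) j ≡ f j
  same j with eqB j i in q
  ... | true = trans (∧-zeroʳ (f j ∨ true)) (sym (trans (cong f (eqB⇒≡ q)) p))
  ... | false with f j
  ...   | true = refl
  ...   | false = refl

subset-of-size : ∀ {n} (f : Fin n → Bool) k → k ≤ # f → ∃ λ t → (t ⊑ f) × (# t ≡ k)
subset-of-size {n} f zero le = (λ _ → false) , (λ i ()) , #-none {n} (λ _ → refl)
subset-of-size f (suc k) le with subset-of-size f k (≤-trans (m≤n⇒m≤1+n ≤-refl) le)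
... | t , t⊑f , #t with ¬∀⟶∃¬ _ (λ i → f i ≡ true → t i ≡ true)
      (λ i → (f i ≟ᵇ true) →-dec (t i ≟ᵇ true)) (λ h → 1+n≰n (≤-trans le (≤-trans (#-mono h) (≤-reflexive #t))))
...   | i , h with true? (f i) | true? (t i)
...     | _ | inj₁ q = ⊥-elim (h (λ _ → q))
...     | inj₂ p | _ = ⊥-elim (h (λ p′ → clash p′ p))
...     | inj₁ p | inj₂ q = t ∪̇ i , sub , trans (#-∪̇ t i q) (cong suc #t)
  where
  sub : t ∪̇ i ⊑ f
  sub j r with eqB j i in e
  ... | true = trans (cong f (eqB⇒≡ e)) p
  ... | false with t j in s
  ...   | true = t⊑f j s

odd : ℕ → Bool
odd zero = false
odd (suc n) = not (odd n)

⨁-odd : ∀ {n} (f : Fin n → Bool) → ⨁ f ≡ odd (# f)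
⨁-odd {zero} f = refl
⨁-odd {suc n} f with f zero
... | true = cong not (⨁-odd (f ∘ suc))
... | false = ⨁-odd (f ∘ suc)

-- The size `k` is a parameter, and not `# f` itself, so that a known cardinality can be substituted
-- and the elements named by numerals.
record Enumeration {n} (f : Fin n → Bool) (k : ℕ) : Set where
  field
    enum      : Fin k → Fin n
    enum-∈    : ∀ j → f (enum j) ≡ true
    index     : ∀ i → f i ≡ true → ∃ λ j → enum j ≡ i
    enum-inj  : ∀ {j k} → enum j ≡ enum k → j ≡ k

abstract
  enumerate : ∀ {n} (f : Fin n → Bool) → Enumeration f (# f)
  enumerate {zero} f = record { enum = λ () ; enum-∈ = λ () ; index = λ () ; enum-inj = λ { {()} } }
  enumerate {suc n} f with enumerate (f ∘ suc) | f zero in p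
  ... | E | true = record
    { enum = λ { zero → zero ; (suc j) → suc (enum j) }
    ; enum-∈ = λ { zero → p ; (suc j) → enum-∈ j }
    ; index = λ { zero _ → zero , refl ; (suc i) h → suc (proj₁ (index i h)) , cong suc (proj₂ (index i h)) }
    ; enum-inj = λ { {zero} {zero} _ → refl ; {suc j} {suc k} e → cong suc (enum-inj (Fin-suc-injective e)) } }
    where
    open Enumeration E
  ... | E | false = record
    { enum = λ j → suc (enum j)
    ; enum-∈ = enum-∈
    ; index = λ { zero h → clash h p ; (suc i) h → proj₁ (index i h) , cong suc (proj₂ (index i h)) }
    ; enum-inj = λ e → enum-inj (Fin-suc-injective e) }
    where
    open Enumeration E

-- Reading the boolean definitions as propositions.

all-elim : ∀ {A : Set} (p : A → Bool) {xs x} → all p xs ≡ true → x ∈ xs → p x ≡ true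
all-elim p {y ∷ xs} h (here refl) = proj₁ (∧-split h)
all-elim p {y ∷ xs} h (there m) = all-elim p (proj₂ (∧-split {p y} h)) m

all-intro : ∀ {A : Set} (p : A → Bool) xs → (∀ x → p x ≡ true) → all p xs ≡ true
all-intro p [] h = refl
all-intro p (x ∷ xs) h = cong₂ _∧_ (h x) (all-intro p xs h)

all-counterexample : ∀ {A : Set} (p : A → Bool) xs → all p xs ≡ false → ∃ λ x → p x ≡ false
all-counterexample p (x ∷ xs) h with true? (p x)
... | inj₂ q = x , q
... | inj₁ q = all-counterexample p xs (trans (cong (_∧ all p xs) (sym q)) h)

any-∈ : ∀ {A : Set} (p : A → Bool) xs → any p xs ≡ true → ∃ λ x → (x ∈ xs) × (p x ≡ true)
any-∈ p (x ∷ xs) h with true? (p x)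
... | inj₁ q = x , here refl , q
... | inj₂ q with any-∈ p xs (trans (cong (_∨ any p xs) (sym q)) h)
...   | y , m , r = y , there m , r

any-witness : ∀ {A : Set} (p : A → Bool) xs → any p xs ≡ true → ∃ λ x → p x ≡ true
any-witness p xs h = let x , _ , q = any-∈ p xs h in x , q

any-intro : ∀ {A : Set} (p : A → Bool) {xs x} → x ∈ xs → p x ≡ true → any p xs ≡ true
any-intro p {y ∷ xs} (here refl) q = cong (_∨ any p xs) q
any-intro p {y ∷ xs} (there m) q = trans (cong (p y ∨_) (any-intro p m q)) (∨-zeroʳ (p y))

∈-subsets : ∀ {m} (T : Subset m) → T ∈ subsets m
∈-subsets [] = here refl
∈-subsets {suc m} (inside ∷ T) = ∈-++⁺ˡ (∈-map⁺ (inside ∷_) (∈-subsets T))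
∈-subsets {suc m} (outside ∷ T) = ∈-++⁺ʳ (map (inside ∷_) (subsets m)) (∈-map⁺ (outside ∷_) (∈-subsets T))

∣∣≡# : ∀ {m} (T : Subset m) → ∣ T ∣ ≡ # (lookup T)
∣∣≡# [] = refl
∣∣≡# (true ∷ T) = cong suc (∣∣≡# T)
∣∣≡# (false ∷ T) = ∣∣≡# T

foldr-xor : ∀ {k m} (h : Fin k → Bool) (g : Fin m → Fin k) →
            foldr (λ e acc → h e xor acc) false (List.tabulate g) ≡ ⨁ (h ∘ g)
foldr-xor {m = zero} h g = refl
foldr-xor {m = suc m} h g = cong (h (g zero) xor_) (foldr-xor h (g ∘ suc))

sumCols-⨁ : ∀ {m k} (c : Fin m → Fin k → Bool) T i → sumCols c T i ≡ ⨁ (λ e → lookup T e ∧ c e i)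
sumCols-⨁ c T i = foldr-xor (λ e → lookup T e ∧ c e i) id

-- Linear algebra over GF(2)

infixr 7 _•_
_•_ : ∀ {m k} → (Fin m → Bool) → (Fin m → Fin k → Bool) → Fin k → Bool
(y • c) i = ⨁ (λ e → y e ∧ c e i)

•-congˡ : ∀ {m k} {y z : Fin m → Bool} (c : Fin m → Fin k → Bool) → y ≗ z → y • c ≗ z • c
•-congˡ c h i = ⨁-cong (λ e → cong (_∧ c e i) (h e))

•-congʳ : ∀ {m k} (y : Fin m → Bool) {c d : Fin m → Fin k → Bool} → (∀ e → c e ≗ d e) → y • c ≗ y • d
•-congʳ y h i = ⨁-cong (λ e → cong (y e ∧_) (h e i))

•-xor : ∀ {m k} (y z : Fin m → Bool) (c : Fin m → Fin k → Bool) i →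
        ((λ e → y e xor z e) • c) i ≡ (y • c) i xor (z • c) i
•-xor y z c i = trans (⨁-cong (λ e → ∧-distribʳ-xor (c e i) (y e) (z e))) (⨁-xor (λ e → y e ∧ c e i) (λ e → z e ∧ c e i))

•-scale : ∀ {m k} s (y : Fin m → Bool) (c : Fin m → Fin k → Bool) i → ((λ e → s ∧ y e) • c) i ≡ s ∧ (y • c) i
•-scale s y c i = trans (⨁-cong (λ e → ∧-assoc s (y e) (c e i))) (sym (⨁-∧ˡ s (λ e → y e ∧ c e i)))

•-δ : ∀ {m k} (c : Fin m → Fin k → Bool) e i → (eqB e • c) i ≡ c e i
•-δ c e i = ⨁-δ (λ e′ → c e′ i) e

•-assoc : ∀ {p q k} (x : Fin p → Bool) (a : Fin p → Fin q → Bool) (g : Fin q → Fin k → Bool) →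
          x • (λ j → a j • g) ≗ (x • a) • g
•-assoc x a g i = begin
  ⨁ (λ j → x j ∧ ⨁ (λ l → a j l ∧ g l i))      ≡⟨ ⨁-cong (λ j → ⨁-∧ˡ (x j) (λ l → a j l ∧ g l i)) ⟩
  ⨁ (λ j → ⨁ (λ l → x j ∧ (a j l ∧ g l i)))    ≡⟨ ⨁-swap (λ j l → x j ∧ (a j l ∧ g l i)) ⟩
  ⨁ (λ l → ⨁ (λ j → x j ∧ (a j l ∧ g l i)))    ≡⟨ ⨁-cong (λ l → ⨁-cong (λ j → sym (∧-assoc (x j) (a j l) (g l i)))) ⟩
  ⨁ (λ l → ⨁ (λ j → (x j ∧ a j l) ∧ g l i))    ≡⟨ ⨁-cong (λ l → sym (⨁-∧ʳ (λ j → x j ∧ a j l) (g l i))) ⟩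
  ⨁ (λ l → ⨁ (λ j → x j ∧ a j l) ∧ g l i)      ∎
  where open ≡-Reasoning

Nonzero : ∀ {m} → (Fin m → Bool) → Set
Nonzero y = ∃ λ e → y e ≡ true

IndepSet : ∀ {m k} → (Fin m → Fin k → Bool) → (Fin m → Bool) → Set
IndepSet c f = ∀ y → y ⊑ f → (∀ i → (y • c) i ≡ false) → ∀ e → y e ≡ false

Indep : ∀ {p k} → (Fin p → Fin k → Bool) → Set
Indep f = ∀ x → (∀ i → (x • f) i ≡ false) → ∀ j → x j ≡ false

InSpan : ∀ {p k} → (Fin k → Bool) → (Fin p → Fin k → Bool) → Set
InSpan v g = ∃ λ a → v ≗ a • g

-- q equations in p > q unknowns: two of the 2^p inputs have equal images.
nonzero-kernel : ∀ {p q} (M : Fin p → Fin q → Bool) → q < p →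
                 ∃ λ x → Nonzero x × (∀ j → (x • M) j ≡ false)
nonzero-kernel {p} {q} M q<p = x , nonzero , kernel
  where
  toB : Fin 2 → Bool
  toB zero = false
  toB (suc _) = true
  fromB : Bool → Fin 2
  fromB false = zero
  fromB true = suc zero
  from-to : ∀ a → fromB (toB a) ≡ a
  from-to zero = refl
  from-to (suc zero) = refl
  to-from : ∀ b → toB (fromB b) ≡ b
  to-from true = refl
  to-from false = refl
  input : Fin (2 ^ p) → Fin p → Bool
  input s i = toB (finToFun {2} {p} s i)
  image : Fin (2 ^ p) → Fin q → Bool
  image s = input s • M
  code : Fin (2 ^ p) → Fin (2 ^ q)
  code s = funToFin (λ j → fromB (image s j))
  collision = pigeonhole (^-monoʳ-< 2 (s≤s (s≤s z≤n)) q<p) code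
  s = proj₁ collision
  t = proj₁ (proj₂ collision)
  s≢t : s ≢ t
  s≢t = <⇒≢ (proj₁ (proj₂ (proj₂ collision)))
  decode : ∀ u j → toB (finToFun {2} {q} (code u) j) ≡ image u j
  decode u j = trans (cong toB (finToFun-funToFin (λ j → fromB (image u j)) j)) (to-from _)
  same : ∀ j → image s j ≡ image t j
  same j = trans (sym (decode s j)) (trans (cong (λ u → toB (finToFun {2} {q} u j)) (proj₂ (proj₂ (proj₂ collision)))) (decode t j))
  x : Fin p → Bool
  x i = input s i xor input t i
  kernel : ∀ j → (x • M) j ≡ false
  kernel j = trans (•-xor (input s) (input t) M j) (trans (cong (_xor image t j) (same j)) (xor-same (image t j)))
  nonzero : Nonzero x
  nonzero with ¬∀⟶∃¬ p (λ i → finToFun {2} {p} s i ≡ finToFun {2} {p} t i) (λ i → _ ≟ _)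
                 (λ h → s≢t (trans (sym (funToFin-finToFin {p} s)) (trans (funToFin-cong h) (funToFin-finToFin {p} t))))
    where
    funToFin-cong : ∀ {r} {f g : Fin r → Fin 2} → f ≗ g → funToFin f ≡ funToFin g
    funToFin-cong {zero} h = refl
    funToFin-cong {suc r} h = cong₂ combine (h zero) (funToFin-cong (h ∘ suc))
  ... | i , h with true? (x i)
  ...   | inj₁ e = i , e
  ...   | inj₂ e = ⊥-elim (h (trans (sym (from-to _)) (trans (cong fromB (xor-≡ e)) (from-to _))))

-- With f = a g for a p × q coefficient matrix `a`, p > q would give a nonzero x with x a = 0, hence
-- x f = 0, a dependency among the f.
steinitz : ∀ {p q k} (f : Fin p → Fin k → Bool) (g : Fin q → Fin k → Bool) →
           Indep f → (∀ j → InSpan (f j) g) → p ≤ q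
steinitz f g ind sp = ≮⇒≥ (λ q<p → absurd (nonzero-kernel a q<p))
  where
  a = λ j → proj₁ (sp j)
  absurd : ¬ (∃ λ x → Nonzero x × (∀ j → (x • a) j ≡ false))
  absurd (x , (j , xj) , z) = clash xj (ind x (λ i → trans (•-congʳ x (λ j → proj₂ (sp j)) i)
    (trans (•-assoc x a g i) (⨁-false (λ l → cong (_∧ g l i) (z l))))) j)

span-xor : ∀ {p k} {u v : Fin k → Bool} (g : Fin p → Fin k → Bool) →
           InSpan u g → InSpan v g → InSpan (λ i → u i xor v i) g
span-xor g (a , h) (b , h′) = (λ j → a j xor b j) , λ i → trans (cong₂ _xor_ (h i) (h′ i)) (sym (•-xor a b g i))

span-cong : ∀ {p k} {u v : Fin k → Bool} (g : Fin p → Fin k → Bool) → u ≗ v → InSpan v g → InSpan u g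
span-cong g h (a , h′) = a , λ i → trans (h i) (h′ i)

subsetB-true : ∀ {m} (T S : Subset m) → lookup T ⊑ lookup S → subsetB T S ≡ true
subsetB-true {m} T S h = all-intro _ (allFin m) one
  where
  one : ∀ e → not (lookup T e) ∨ lookup S e ≡ true
  one e with true? (lookup T e)
  ... | inj₁ p = trans (cong (λ b → not b ∨ lookup S e) p) (h e p)
  ... | inj₂ p = cong (λ b → not b ∨ lookup S e) p

subsetB-⊑ : ∀ {m} (T S : Subset m) → subsetB T S ≡ true → lookup T ⊑ lookup S
subsetB-⊑ T S h e p = trans (sym (cong (λ b → not b ∨ lookup S e) p)) (all-elim _ h (∈-allFin e))

zeroVecB-zero : ∀ {k} (x : Fin k → Bool) → zeroVecB x ≡ true → ∀ i → x i ≡ false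
zeroVecB-zero x h i with x i | all-elim (λ i → not (x i)) h (∈-allFin i)
... | false | _ = refl

independentB-sound : ∀ {m k} (c : Fin m → Fin k → Bool) T → independentB c T ≡ true → IndepSet c (lookup T)
independentB-sound {m} {k} c T h y y⊑T z e with true? (y e)
... | inj₂ p = p
... | inj₁ p = clash (all-elim _ h (∈-subsets Y)) (cong₂ _∨_ (cong₂ (λ a b → not (a ∧ b)) sub ne) (cong not zv))
  where
  Y = tabulate y
  Y≗y : ∀ e → lookup Y e ≡ y e
  Y≗y = lookup∘tabulate y
  sub : subsetB Y T ≡ true
  sub = subsetB-true Y T (λ e q → y⊑T e (trans (sym (Y≗y e)) q))
  ne : nonemptyB Y ≡ true
  ne = any-intro (lookup Y) (∈-allFin e) (trans (Y≗y e) p)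
  zv : zeroVecB (sumCols c Y) ≡ true
  zv = all-intro _ (allFin k) (λ i → cong not (trans (sumCols-⨁ c Y i) (trans (•-congˡ c Y≗y i) (z i))))

independentB-false : ∀ {m k} (c : Fin m → Fin k → Bool) T → independentB c T ≡ false →
                     ∃ λ y → (y ⊑ lookup T) × Nonzero y × (∀ i → (y • c) i ≡ false)
independentB-false {m} c T h with all-counterexample _ (subsets m) h
... | Y , q with subsetB Y T in s | nonemptyB Y in n | zeroVecB (sumCols c Y) in z
...   | true | true | true = lookup Y , subsetB-⊑ Y T s , any-witness _ (allFin m) n ,
        λ i → trans (sym (sumCols-⨁ c Y i)) (zeroVecB-zero _ z i)

rank-lower : ∀ {m k} (c : Fin m → Fin k → Bool) S f → f ⊑ lookup S → IndepSet c f → # f ≤ rank c S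
rank-lower {m} c S f f⊑S ind = subst (_≤ rank c S) (trans (∣∣≡# F) (#-cong F≗f)) (go (subsets m) (∈-subsets F))
  where
  F = tabulate f
  F≗f : ∀ e → lookup F e ≡ f e
  F≗f = lookup∘tabulate f
  good : subsetB F S ∧ independentB c F ≡ true
  good = cong₂ _∧_ (subsetB-true F S (λ e q → f⊑S e (trans (sym (F≗f e)) q))) indB
    where
    indB : independentB c F ≡ true
    indB with true? (independentB c F)
    ... | inj₁ p = p
    ... | inj₂ p with independentB-false c F p
    ...   | y , y⊑F , (e , ye) , z = clash ye (ind y (λ e q → trans (sym (F≗f e)) (y⊑F e q)) z e)
  go : ∀ xs → F ∈ xs → ∣ F ∣ ≤ foldr (λ T acc → if subsetB T S ∧ independentB c T then ∣ T ∣ ⊔ acc else acc) 0 xs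
  go (T ∷ xs) (here refl) rewrite good = m≤m⊔n _ _
  go (T ∷ xs) (there m) with subsetB T S ∧ independentB c T
  ... | true = ≤-trans (go xs m) (m≤n⊔m ∣ T ∣ _)
  ... | false = go xs m

abstract
  rank-attained : ∀ {m k} (c : Fin m → Fin k → Bool) S →
                  ∃ λ f → (f ⊑ lookup S) × IndepSet c f × (# f ≡ rank c S)
  rank-attained {m} c S = go (subsets m)
    where
    go : ∀ xs → ∃ λ f → (f ⊑ lookup S) × IndepSet c f ×
         (# f ≡ foldr (λ T acc → if subsetB T S ∧ independentB c T then ∣ T ∣ ⊔ acc else acc) 0 xs)
    go [] = (λ _ → false) , (λ _ ()) , (λ y y⊑ z e → not-true (λ q → true≢false (sym (y⊑ e q)))) , #-none {m} (λ _ → refl)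
    go (T ∷ xs) with subsetB T S in p | independentB c T in q
    ... | false | _ = go xs
    ... | true | false = go xs
    ... | true | true with ⊔-sel ∣ T ∣ (foldr (λ T acc → if subsetB T S ∧ independentB c T then ∣ T ∣ ⊔ acc else acc) 0 xs)
    ...   | inj₁ e = lookup T , subsetB-⊑ T S p , independentB-sound c T q , trans (sym (∣∣≡# T)) (sym e)
    ...   | inj₂ e with go xs
    ...     | f , f⊑ , ind , e′ = f , f⊑ , ind , trans e′ (sym e)

-- The rank is an index of the record so that rank 0 and rank 1 can later be analysed by matching on
-- it.
record Basis {m k} (c : Fin m → Fin k → Bool) (S : Fin m → Bool) (r : ℕ) : Set where
  field
    elt    : Fin r → Fin m
    elt-∈  : ∀ j → S (elt j) ≡ true
    indep  : Indep (c ∘ elt)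
    spans  : ∀ e → S e ≡ true → InSpan (c e) (c ∘ elt)

indep-or-dependent : ∀ {m k} (c : Fin m → Fin k → Bool) f →
  IndepSet c f ⊎ (∃ λ y → (y ⊑ f) × Nonzero y × (∀ i → (y • c) i ≡ false))
indep-or-dependent c f with independentB c (tabulate f) in p
... | true = inj₁ λ y y⊑f → independentB-sound c (tabulate f) p y
                 (λ e q → trans (lookup∘tabulate f e) (y⊑f e q))
... | false with independentB-false c (tabulate f) p
...   | y , y⊑ , n , z = inj₂ (y , (λ e q → trans (sym (lookup∘tabulate f e)) (y⊑ e q)) , n , z)

module _ {n} {X : Fin n → Bool} {k} (E : Enumeration X k) where
  open Enumeration E

  -- Extension by zero from the enumerated set to all of `Fin n`. Written as a combination of unit
  -- vectors, it passes through any matrix by `•-assoc`.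
  spread : (Fin k → Bool) → Fin n → Bool
  spread x = x • (λ j e → eqB e (enum j))

  spread-enum : ∀ x j → spread x (enum j) ≡ x j
  spread-enum x j = trans (⨁-cong eq) (⨁-δ′ x j)
    where
    eq : ∀ l → x l ∧ eqB (enum j) (enum l) ≡ x l ∧ eqB l j
    eq l with eqB l j in p
    ... | true = cong (x l ∧_) (trans (cong (λ l → eqB (enum j) (enum l)) (eqB⇒≡ p)) (eqB-refl _))
    ... | false = cong (x l ∧_) (eqB-≢ (λ q → eqB⇒≢ p (sym (enum-inj q))))

  spread-⊑ : ∀ x → spread x ⊑ X
  spread-⊑ x e p with ⨁-witness p
  ... | j , q = trans (cong X (eqB⇒≡ (proj₂ (∧-split {x j} q)))) (enum-∈ j)

  spread-∉ : ∀ x i → X i ≡ false → spread x i ≡ false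
  spread-∉ x i p = not-true (λ q → clash (spread-⊑ x i q) p)

  spread-• : ∀ {m} (c : Fin n → Fin m → Bool) x i → (spread x • c) i ≡ (x • (c ∘ enum)) i
  spread-• c x i = trans (sym (•-assoc x (λ j e → eqB e (enum j)) c i))
    (•-congʳ x (λ j i → trans (⨁-cong (λ e → cong (_∧ c e i) (eqB-sym e (enum j)))) (•-δ c (enum j) i)) i)

  restrict-• : ∀ {m} (c : Fin n → Fin m → Bool) y → y ⊑ X → ∀ i → (y • c) i ≡ ((y ∘ enum) • (c ∘ enum)) i
  restrict-• c y y⊑X i = trans (•-congˡ c same i) (spread-• c (y ∘ enum) i)
    where
    same : y ≗ spread (y ∘ enum)
    same e with true? (X e)
    ... | inj₁ p with index e p
    ...   | j , refl = sym (spread-enum (y ∘ enum) j)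
    same e | inj₂ p = trans (not-true (λ q → clash (y⊑X e q) p)) (sym (spread-∉ (y ∘ enum) e p))

abstract
  -- A maximum independent subset f of S spans S: adding another element e would exceed the rank, so
  -- f with e is dependent. The dependency involves e because f is independent, and its remaining
  -- terms express the column of e.
  basis : ∀ {m k} (c : Fin m → Fin k → Bool) S → Basis c (lookup S) (rank c S)
  basis {m} {k} c S with rank-attained c S
  ... | f , f⊑S , ind , #f = subst (Basis c (lookup S)) #f (record
      { elt = enum
      ; elt-∈ = λ j → f⊑S _ (enum-∈ j)
      ; indep = independent
      ; spans = λ e p → spanning e p })
    where
    open Enumeration (enumerate f)
    independent : Indep (c ∘ enum)
    independent x z j = trans (sym (spread-enum (enumerate f) x j))
      (ind (spread (enumerate f) x) (spread-⊑ (enumerate f) x) (λ i → trans (spread-• (enumerate f) c x i) (z i)) (enum j))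
    spanning : ∀ e → lookup S e ≡ true → InSpan (c e) (c ∘ enum)
    spanning e e∈S with true? (f e)
    ... | inj₁ p with index e p
    ...   | j , refl = eqB j , λ i → sym (•-δ (c ∘ enum) j i)
    spanning e e∈S | inj₂ p with indep-or-dependent c (f ∪̇ e)
    ... | inj₁ ind′ = ⊥-elim (1+n≰n (≤-trans (≤-reflexive (trans (cong suc (sym #f)) (sym (#-∪̇ f e p))))
                         (rank-lower c S (f ∪̇ e) sub ind′)))
      where
      sub : f ∪̇ e ⊑ lookup S
      sub j q with j ≟ e
      ... | yes refl = e∈S
      ... | no ne = f⊑S j (trans (sym (∨-identityʳ (f j))) q)
    ... | inj₂ (y , y⊑ , (e′ , ye′) , z) = (y′ ∘ enum) , λ i → trans (col i) (restrict-• (enumerate f) c y′ y′⊑f i)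
      where
      y′ : Fin m → Bool
      y′ = y ∖ e
      y′⊑f : y′ ⊑ f
      y′⊑f j q = trans (sym (∪̇-≢ f (∖-≢ y q))) (y⊑ j (∖-⊑ y e j q))
      e∈y : y e ≡ true
      e∈y with true? (y e)
      ... | inj₁ q = q
      ... | inj₂ q = clash ye′ (ind y (λ j r → trans (sym (∪̇-≢ f (λ { refl → clash r q }))) (y⊑ j r)) z e′)
      decompose : ∀ j → y j ≡ eqB e j xor y′ j
      decompose j with e ≟ j
      ... | yes refl = trans e∈y (cong not (sym (∖-self y e)))
      ... | no ne = sym (trans (cong (λ b → y j ∧ not b) (eqB-≢ (ne ∘ sym))) (∧-identityʳ (y j)))
      col : ∀ i → c e i ≡ (y′ • c) i
      col i = xor-≡ (trans (cong (_xor (y′ • c) i) (sym (•-δ c e i)))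
        (trans (sym (•-xor (eqB e) y′ c i)) (trans (•-congˡ c (λ j → sym (decompose j)) i) (z i))))

rank-upper : ∀ {m k q} (c : Fin m → Fin k → Bool) S (g : Fin q → Fin k → Bool) →
             (∀ e → lookup S e ≡ true → InSpan (c e) g) → rank c S ≤ q
rank-upper c S g h = steinitz (c ∘ elt) g indep (λ j → h _ (elt-∈ j))
  where open Basis (basis c S)

rank-lower-family : ∀ {m k p} (c : Fin m → Fin k → Bool) S (e : Fin p → Fin m) →
                    (∀ j → lookup S (e j) ≡ true) → Indep (c ∘ e) → p ≤ rank c S
rank-lower-family c S e h ind = steinitz (c ∘ e) (c ∘ elt) ind (λ j → spans _ (h j))
  where open Basis (basis c S)

lookup-⊤ : ∀ {m} (e : Fin m) → lookup ⊤ e ≡ true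
lookup-⊤ e = lookup-replicate e true

lookup-∁ : ∀ {m} (S : Subset m) e → lookup (∁ S) e ≡ not (lookup S e)
lookup-∁ S e = lookup-map e not S

-- Row rank bounds column rank: if every row d i is a combination of r basis rows, the r vectors of
-- coefficients, indexed by i, span the columns of the same matrix.
rank-transpose : ∀ {m k} (c : Fin m → Fin k → Bool) (d : Fin k → Fin m → Bool) →
                 (∀ e i → c e i ≡ d i e) → rank c ⊤ ≤ rank d ⊤
rank-transpose c d h = rank-upper c ⊤ (λ l i → proj₁ (spans i (lookup-⊤ i)) l)
  (λ e _ → (λ l → d (elt l) e) , λ i → trans (h e i) (trans (proj₂ (spans i (lookup-⊤ i)) e) (⨁-cong (λ l → ∧-comm _ (d (elt l) e)))))
  where open Basis (basis d ⊤)

•-++ : ∀ {p q k} (x : Fin (p + q) → Bool) (g : Fin p → Fin k → Bool) (h : Fin q → Fin k → Bool) i →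
       (x • (g ++ h)) i ≡ ((λ j → x (j ↑ˡ q)) • g) i xor ((λ l → x (p ↑ʳ l)) • h) i
•-++ {p} {q} x g h i = trans (⨁-++ p (λ j → x j ∧ (g ++ h) j i)) (cong₂ _xor_
  (⨁-cong (λ j → cong (λ s → x (j ↑ˡ q) ∧ [ g , h ]′ s i) (splitAt-↑ˡ p j q)))
  (⨁-cong (λ l → cong (λ s → x (p ↑ʳ l) ∧ [ g , h ]′ s i) (splitAt-↑ʳ p q l))))

span-++ : ∀ {p q k} {u v : Fin k → Bool} (g : Fin p → Fin k → Bool) (h : Fin q → Fin k → Bool) →
          InSpan u g → InSpan v h → InSpan (λ i → u i xor v i) (g ++ h)
span-++ {p} {q} g h (a , ha) (b , hb) = a ++ b , λ i → sym (trans (•-++ (a ++ b) g h i) (cong₂ _xor_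
  (trans (•-congˡ g (λ j → cong [ a , b ]′ (splitAt-↑ˡ p j q)) i) (sym (ha i)))
  (trans (•-congˡ h (λ l → cong [ a , b ]′ (splitAt-↑ʳ p q l)) i) (sym (hb i)))))

span-zero : ∀ {p k} (g : Fin p → Fin k → Bool) → InSpan (λ _ → false) g
span-zero {p} g = (λ _ → false) , λ i → sym (⨁-false {p} (λ _ → refl))

-- The isotropic matroid and cut-rank

module _ {n : ℕ} where

  φ χ ψ : Fin n → Fin (n + (n + n))
  φ v = v ↑ˡ (n + n)
  χ v = n ↑ʳ (v ↑ˡ n)
  ψ v = n ↑ʳ (n ↑ʳ v)

  vertexOf : Fin (n + (n + n)) → Fin n
  vertexOf e = [ id , (λ e′ → [ id , id ]′ (splitAt n e′)) ]′ (splitAt n e)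

  vertexOf-φ : ∀ v → vertexOf (φ v) ≡ v
  vertexOf-φ v rewrite splitAt-↑ˡ n v (n + n) = refl

  vertexOf-χ : ∀ v → vertexOf (χ v) ≡ v
  vertexOf-χ v rewrite splitAt-↑ʳ n (n + n) (v ↑ˡ n) | splitAt-↑ˡ n v n = refl

  element-cases : ∀ e → (e ≡ φ (vertexOf e)) ⊎ (e ≡ χ (vertexOf e)) ⊎ (e ≡ ψ (vertexOf e))
  element-cases e with splitAt n e in p
  ... | inj₁ v = inj₁ (trans (sym (join-splitAt n (n + n) e)) (cong (join n (n + n)) p))
  ... | inj₂ e′ with splitAt n e′ in q
  ...   | inj₁ v = inj₂ (inj₁ (trans (sym (join-splitAt n (n + n) e)) (trans (cong (join n (n + n)) p)
                     (cong (n ↑ʳ_) (trans (sym (join-splitAt n n e′)) (cong (join n n) q))))))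
  ...   | inj₂ v = inj₂ (inj₂ (trans (sym (join-splitAt n (n + n) e)) (trans (cong (join n (n + n)) p)
                     (cong (n ↑ʳ_) (trans (sym (join-splitAt n n e′)) (cong (join n n) q))))))

  IAS-φ : ∀ (G : Graph n) v i → IAS G (φ v) i ≡ eqB i v
  IAS-φ G v i rewrite splitAt-↑ˡ n v (n + n) = refl

  IAS-χ : ∀ (G : Graph n) v i → IAS G (χ v) i ≡ G i v
  IAS-χ G v i rewrite splitAt-↑ʳ n (n + n) (v ↑ˡ n) | splitAt-↑ˡ n v n = refl

  IAS-ψ : ∀ (G : Graph n) v i → IAS G (ψ v) i ≡ G i v xor eqB i v
  IAS-ψ G v i rewrite splitAt-↑ʳ n (n + n) (n ↑ʳ v) | splitAt-↑ʳ n n v = refl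

-- Restriction of the adjacency matrix to rows outside X and columns in X, padded with zeros.
cut : ∀ {n} → Graph n → (Fin n → Bool) → Fin n → Fin n → Bool
cut G X v i = not (X i) ∧ (X v ∧ G i v)

cutrank : ∀ {n} → Graph n → (Fin n → Bool) → ℕ
cutrank G X = rank (cut G X) ⊤

-- For symmetric `G`, the padded matrices of X and of V - X are transposes of each other.
cutrank-∁ : ∀ {n} (G : Graph n) → IsGraph G → ∀ X → cutrank G (not ∘ X) ≡ cutrank G X
cutrank-∁ G sy X = ≤-antisym (rank-transpose (cut G (not ∘ X)) (cut G X) h)
                             (rank-transpose (cut G X) (cut G (not ∘ X)) (λ v i → sym (h i v)))
  where
  h : ∀ v i → cut G (not ∘ X) v i ≡ cut G X i v
  h v i rewrite sy i v with X i | X v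
  ... | true | true = refl
  ... | true | false = refl
  ... | false | true = refl
  ... | false | false = refl

majority : Bool → Bool → Bool → Bool
majority a b c = (a ∧ b) ∨ (a ∧ c) ∨ (b ∧ c)

-- Self-duality of the majority: S and W - S select complementary vertex sets, so one rank bound
-- serves both sides.
not-majority : ∀ a b c → not (majority a b c) ≡ majority (not a) (not b) (not c)
not-majority true true true = refl
not-majority true true false = refl
not-majority true false true = refl
not-majority true false false = refl
not-majority false true true = refl
not-majority false true false = refl
not-majority false false true = refl
not-majority false false false = refl

majoritySet : ∀ {n} → (Fin (n + (n + n)) → Bool) → Fin n → Bool
majoritySet s v = majority (s (φ v)) (s (χ v)) (s (ψ v))

module _ {n} (G : Graph n) where

  -- Columns of vertices outside X are padded with zeros, and a zero column cannot belong to an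
  -- independent family.
  cut-indep-⊑ : ∀ X {r} (e : Fin r → Fin n) → Indep (cut G X ∘ e) → ∀ l → X (e l) ≡ true
  cut-indep-⊑ X e ind l with true? (X (e l))
  ... | inj₁ p = p
  ... | inj₂ p = clash (eqB-refl l) (ind (eqB l) (λ i → trans (•-δ (cut G X ∘ e) l i)
                   (trans (cong (λ b → not (X i) ∧ (b ∧ G i (e l))) p) (∧-zeroʳ (not (X i))))) l)

  module _ (X : Fin n → Bool) (S : Subset (n + (n + n))) (S≗X : ∀ e → lookup S e ≡ X (vertexOf e)) where
    open Enumeration (enumerate X)
    open Basis (basis (cut G X) ⊤)

    private
      e[_] : Fin (# X) → Fin n → Bool
      e[ j ] i = eqB i (enum j)

    -- Unit vectors of X together with a column basis of the cut matrix generate everything: a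
    -- column χ(v) with v in X is its part on the rows in X plus its column of the cut matrix, and
    -- ψ(v) = φ(v) + χ(v).
    cylinder-upper : rank (IAS G) S ≤ # X + cutrank G X
    cylinder-upper = rank-upper (IAS G) S gens spanned
      where
      gens = e[_] ++ (cut G X ∘ elt)
      φ-spanned : ∀ v → X v ≡ true → InSpan (λ i → eqB i v) gens
      φ-spanned v p with index v p
      ... | j , refl = span-cong gens (λ i → sym (xor-identityʳ _))
            (span-++ e[_] (cut G X ∘ elt) (eqB j , λ i → sym (•-δ e[_] j i)) (span-zero _))
      χ-spanned : ∀ v → X v ≡ true → InSpan (λ i → G i v) gens
      χ-spanned v p = span-cong gens splits
        (span-++ e[_] (cut G X ∘ elt) ((λ j → G (enum j) v) , inside-part) (spans v (lookup-⊤ v)))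
        where
        splits : ∀ i → G i v ≡ (X i ∧ G i v) xor cut G X v i
        splits i rewrite p with X i
        ... | true = sym (xor-identityʳ _)
        ... | false = refl
        inside-part : ∀ i → X i ∧ G i v ≡ ((λ j → G (enum j) v) • e[_]) i
        inside-part i with true? (X i)
        ... | inj₂ q = trans (cong (_∧ G i v) q) (sym (spread-∉ (enumerate X) (λ j → G (enum j) v) i q))
        ... | inj₁ q with index i q
        ...   | j , refl = trans (cong (_∧ G i v) q) (sym (spread-enum (enumerate X) (λ j → G (enum j) v) j))
      spanned : ∀ e → lookup S e ≡ true → InSpan (IAS G e) gens
      spanned e p with trans (sym (S≗X e)) p | element-cases e
      ... | q | inj₁ h = span-cong gens (λ i → trans (cong (λ e → IAS G e i) h) (IAS-φ G _ i)) (φ-spanned _ q)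
      ... | q | inj₂ (inj₁ h) = span-cong gens (λ i → trans (cong (λ e → IAS G e i) h) (IAS-χ G _ i)) (χ-spanned _ q)
      ... | q | inj₂ (inj₂ h) = span-cong gens (λ i → trans (cong (λ e → IAS G e i) h) (IAS-ψ G _ i))
                                  (span-xor gens (χ-spanned _ q) (φ-spanned _ q))

    -- The elements φ(v) for v in X and χ(v) for a basis of the cut matrix are independent. On rows
    -- outside X the unit vectors vanish, so the χ-coefficients are zero; the rows in X then kill
    -- the φ-coefficients.
    cylinder-lower : # X + cutrank G X ≤ rank (IAS G) S
    cylinder-lower = rank-lower-family (IAS G) S cols mem independent
      where
      cols = (φ ∘ enum) ++ (χ ∘ elt)
      X-elt = cut-indep-⊑ X elt indep
      mem : ∀ j → lookup S (cols j) ≡ true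
      mem j with splitAt (# X) j
      ... | inj₁ l = trans (S≗X _) (trans (cong X (vertexOf-φ _)) (enum-∈ l))
      ... | inj₂ l = trans (S≗X _) (trans (cong X (vertexOf-χ (elt l))) (X-elt l))
      columns : ∀ j → IAS G (cols j) ≗ (e[_] ++ (λ l i → G i (elt l))) j
      columns j i with splitAt (# X) j
      ... | inj₁ l = IAS-φ G _ i
      ... | inj₂ l = IAS-χ G _ i
      independent : Indep (IAS G ∘ cols)
      independent z h j = subst (λ j → z j ≡ false) (join-splitAt (# X) _ j) (vanish (splitAt (# X) j))
        where
        x = λ j → z (j ↑ˡ cutrank G X)
        y = λ l → z (# X ↑ʳ l)
        row : ∀ i → (x • e[_]) i xor (y • (λ l i → G i (elt l))) i ≡ false
        row i = trans (sym (•-++ z e[_] (λ l i → G i (elt l)) i)) (trans (sym (•-congʳ z columns i)) (h i))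
        y-zero : ∀ l → y l ≡ false
        y-zero = indep y cutrow
          where
          cutrow : ∀ i → (y • (cut G X ∘ elt)) i ≡ false
          cutrow i with true? (X i)
          ... | inj₁ p = ⨁-false (λ l → trans (cong (λ b → y l ∧ (not b ∧ (X (elt l) ∧ G i (elt l)))) p) (∧-zeroʳ (y l)))
          ... | inj₂ p = trans (⨁-cong (λ l → cong (y l ∧_) (cong₂ (λ a b → not a ∧ (b ∧ G i (elt l))) p (X-elt l))))
                         (trans (cong (_xor (y • (λ l i → G i (elt l))) i) (sym (spread-∉ (enumerate X) x i p))) (row i))
        x-zero : ∀ j → x j ≡ false
        x-zero j = trans (sym (spread-enum (enumerate X) x j)) (trans (sym (xor-identityʳ _))
          (trans (cong ((x • e[_]) (enum j) xor_) (sym (⨁-false (λ l → cong (_∧ G (enum j) (elt l)) (y-zero l))))) (row (enum j))))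
        vanish : ∀ s → z (join (# X) _ s) ≡ false
        vanish (inj₁ j) = x-zero j
        vanish (inj₂ l) = y-zero l

    rank-cylinder : rank (IAS G) S ≡ # X + cutrank G X
    rank-cylinder = ≤-antisym cylinder-upper cylinder-lower

  rankM-IAS : rankM (IAS G) ≡ n
  rankM-IAS = ≤-antisym
    (rank-upper (IAS G) ⊤ unit (λ e _ → IAS G e , λ i → sym (unit-• (IAS G e) i)))
    (rank-lower-family (IAS G) ⊤ φ (λ j → lookup-⊤ (φ j))
      (λ x h j → trans (sym (unit-• x j)) (trans (sym (•-congʳ x (λ v i → IAS-φ G v i) j)) (h j))))
    where
    unit : Fin n → Fin n → Bool
    unit j i = eqB i j
    unit-• : ∀ x i → (x • unit) i ≡ x i
    unit-• x i = trans (⨁-cong (λ j → cong (x j ∧_) (eqB-sym i j))) (⨁-δ′ x i)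

  -- φ(v) + χ(v) + ψ(v) = 0, so two elements of a triple span the third.
  majority-rank : ∀ S X → X ⊑ majoritySet (lookup S) → # X + cutrank G X ≤ rank (IAS G) S
  majority-rank S X X⊑ = ≤-trans (cylinder-lower X C (λ e → lookup∘tabulate (X ∘ vertexOf) e))
      (rank-upper (IAS G) C gens spanned)
    where
    open Basis (basis (IAS G) S)
    C = tabulate (X ∘ vertexOf)
    gens = IAS G ∘ elt
    Triple : Fin n → Set
    Triple v = InSpan (λ i → eqB i v) gens × InSpan (λ i → G i v) gens
    a∈ : ∀ v → lookup S (φ v) ≡ true → InSpan (λ i → eqB i v) gens
    a∈ v p = span-cong gens (λ i → sym (IAS-φ G v i)) (spans (φ v) p)
    b∈ : ∀ v → lookup S (χ v) ≡ true → InSpan (λ i → G i v) gens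
    b∈ v p = span-cong gens (λ i → sym (IAS-χ G v i)) (spans (χ v) p)
    c∈ : ∀ v → lookup S (ψ v) ≡ true → InSpan (λ i → G i v xor eqB i v) gens
    c∈ v p = span-cong gens (λ i → sym (IAS-ψ G v i)) (spans (ψ v) p)
    cancelˡ : ∀ a b → b ≡ a xor (a xor b)
    cancelˡ true true = refl
    cancelˡ true false = refl
    cancelˡ false b = refl
    cancelʳ : ∀ a b → a ≡ (a xor b) xor b
    cancelʳ true true = refl
    cancelʳ true false = refl
    cancelʳ false true = refl
    cancelʳ false false = refl
    triple : ∀ v → majoritySet (lookup S) v ≡ true → Triple v
    triple v h with lookup S (φ v) in p | lookup S (χ v) in q | lookup S (ψ v) in r
    ... | true | true | _ = a∈ v p , b∈ v q
    ... | true | false | true = a∈ v p , span-cong gens (λ i → cancelʳ _ _) (span-xor gens (c∈ v r) (a∈ v p))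
    ... | false | true | true = span-cong gens (λ i → cancelˡ (G i v) _) (span-xor gens (b∈ v q) (c∈ v r)) , b∈ v q
    spanned : ∀ e → lookup C e ≡ true → InSpan (IAS G e) gens
    spanned e p with triple (vertexOf e) (X⊑ _ (trans (sym (lookup∘tabulate (X ∘ vertexOf) e)) p)) | element-cases e
    ... | a , b | inj₁ h = span-cong gens (λ i → trans (cong (λ e → IAS G e i) h) (IAS-φ G _ i)) a
    ... | a , b | inj₂ (inj₁ h) = span-cong gens (λ i → trans (cong (λ e → IAS G e i) h) (IAS-χ G _ i)) b
    ... | a , b | inj₂ (inj₂ h) = span-cong gens (λ i → trans (cong (λ e → IAS G e i) h) (IAS-ψ G _ i)) (span-xor gens b a)

-- κ as a minimum over vertical separations, expressed by cut-rank.

module _ {m k} (c : Fin m → Fin k → Bool) where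

  private
    minStep : ℕ → ℕ → ℕ
    minStep j acc = if hasVerticalSepB c j then j ⊓ acc else acc

  κ≤rank : κ c ≤ rankM c
  κ≤rank = go (upTo (suc (rankM c)))
    where
    go : ∀ js → foldr minStep (rankM c) js ≤ rankM c
    go [] = ≤-refl
    go (j ∷ js) with hasVerticalSepB c j
    ... | true = ≤-trans (m⊓n≤n j _) (go js)
    ... | false = go js

  κ≤separation : ∀ j → hasVerticalSepB c j ≡ true → κ c ≤ j
  κ≤separation j h with j ≤? rankM c
  -- An order above the rank is not scanned by `κ`, but then the rank is already a smaller bound.
  ... | no j≰ = ≤-trans κ≤rank (<⇒≤ (≰⇒> j≰))
  ... | yes j≤ = go (upTo (suc (rankM c))) (∈-upTo⁺ (s≤s j≤))
    where
    go : ∀ js → j ∈ js → foldr minStep (rankM c) js ≤ j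
    go (i ∷ js) (here refl) rewrite h = m⊓n≤m j _
    go (i ∷ js) (there p) with hasVerticalSepB c i
    ... | true = ≤-trans (m⊓n≤n i _) (go js p)
    ... | false = go js p

  κ-attained : (κ c ≡ rankM c) ⊎ (hasVerticalSepB c (κ c) ≡ true)
  κ-attained = go (upTo (suc (rankM c)))
    where
    go : ∀ js → (foldr minStep (rankM c) js ≡ rankM c) ⊎ (hasVerticalSepB c (foldr minStep (rankM c) js) ≡ true)
    go [] = inj₁ refl
    go (j ∷ js) with hasVerticalSepB c j in p
    ... | false = go js
    ... | true with ⊓-sel j (foldr minStep (rankM c) js)
    ...   | inj₁ e = inj₂ (trans (cong (hasVerticalSepB c) e) p)
    ...   | inj₂ e rewrite e = go js

  κ-separation : κ c < rankM c → hasVerticalSepB c (κ c) ≡ true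
  κ-separation κ<r with κ-attained
  ... | inj₁ e = ⊥-elim (<-irrefl e κ<r)
  ... | inj₂ h = h

-- The arithmetic of λ(S) = r(S) + r(W − S) − n for the cylinder over X, with x = |X|, y = |V − X| and r the cut-rank of X.
private
  module Arithmetic {x y n : ℕ} (x+y≡n : x + y ≡ n) (r : ℕ) where

    cylinder-λ : ∀ {s t} → s ≡ x + r → t ≡ y + r → s + t ∸ n ≡ 2 * r
    cylinder-λ refl refl = trans (cong₂ _∸_ (rearrange x y r) (sym x+y≡n)) (m+n∸m≡n (x + y) (2 * r))
      where
      rearrange : ∀ a b r → (a + r) + (b + r) ≡ (a + b) + (2 * r)
      rearrange = solve-∀

    module _ {s t k} (x+r≤s : x + r ≤ s) (y+r≤t : y + r ≤ t) (conn : s + t ∸ n < k) where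

      1+2r≤k : suc (2 * r) ≤ k
      1+2r≤k = ≤-<-trans (≤-trans (≤-reflexive (sym (cylinder-λ refl refl))) (∸-monoˡ-≤ n (+-mono-≤ x+r≤s y+r≤t))) conn

      -- If s were at least n, then λ = s + t - n would be at least t ≥ k. So x + r ≤ s < n = x + y.
      r<y : k ≤ t → r < y
      r<y k≤t = +-cancelˡ-< x r y (≤-trans (≤-<-trans x+r≤s (≰⇒> λ n≤s → n≮n k
        (≤-<-trans (≤-trans k≤t (≤-trans (≤-reflexive (sym (m+n∸m≡n n t))) (∸-monoˡ-≤ n (+-monoˡ-≤ t n≤s)))) conn)))
        (≤-reflexive (sym x+y≡n)))

      r<x : k ≤ s → r < x
      r<x k≤s = +-cancelˡ-< y r x (≤-trans (≤-<-trans y+r≤t (≰⇒> λ n≤t → n≮n k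
        (≤-<-trans (≤-trans k≤s (≤-trans (≤-reflexive (sym (m+n∸n≡m s n))) (∸-monoˡ-≤ n (+-monoʳ-≤ s n≤t)))) conn)))
        (≤-reflexive (trans (sym x+y≡n) (+-comm x y))))

    -- Supplies the rank condition of a vertical (2r+1)-separation: a side with a vertices has rank
    -- a + r, which is at least 2r + 1 once a > r.
    large : ∀ {a b} → r < a → b ≡ a + r → suc (2 * r) ≤ b
    large {a} h refl = ≤-trans (≤-reflexive (cong (λ t → suc (r + t)) (+-identityʳ r))) (+-monoˡ-≤ r h)

  ≤ᵇ-true : ∀ {a b} → a ≤ b → (a ≤ᵇ b) ≡ true
  ≤ᵇ-true p = Equivalence.to T-≡ (≤⇒≤ᵇ p)

  <ᵇ-true : ∀ {a b} → a < b → (a <ᵇ b) ≡ true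
  <ᵇ-true p = Equivalence.to T-≡ (<⇒<ᵇ p)

separation-intro : ∀ {m k} (c : Fin m → Fin k → Bool) j S →
  connλ c S < j → j ≤ rank c S → j ≤ rank c (∁ S) → hasVerticalSepB c j ≡ true
separation-intro c j S p q r = any-intro (verticalSepB c j) (∈-subsets S) (cong₂ _∧_ (<ᵇ-true p) (cong₂ _∧_ (≤ᵇ-true q) (≤ᵇ-true r)))

separation-elim : ∀ {m k} (c : Fin m → Fin k → Bool) j → hasVerticalSepB c j ≡ true →
  ∃ λ S → (connλ c S < j) × (j ≤ rank c S) × (j ≤ rank c (∁ S))
separation-elim {m} c j h with any-witness (verticalSepB c j) (subsets m) h
... | S , sep = S , <ᵇ⇒< _ _ (fromTrue (proj₁ p)) , ≤ᵇ⇒≤ _ _ (fromTrue (proj₁ q)) , ≤ᵇ⇒≤ _ _ (fromTrue (proj₂ q))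
  where
  p = ∧-split {connλ c S <ᵇ j} sep
  q = ∧-split {j ≤ᵇ rank c S} (proj₂ p)
  fromTrue : ∀ {b} → b ≡ true → T b
  fromTrue = Equivalence.from T-≡

κ≤n : ∀ {n} (G : Graph n) → κ (IAS G) ≤ n
κ≤n G = ≤-trans (κ≤rank (IAS G)) (≤-reflexive (rankM-IAS G))

module _ {n} (G : Graph n) (sy : IsGraph G) where

  κ≤cutrank : ∀ X → cutrank G X < # X → cutrank G X < # (not ∘ X) → κ (IAS G) ≤ suc (2 * cutrank G X)
  κ≤cutrank X p q = κ≤separation (IAS G) (suc (2 * r)) (separation-intro (IAS G) (suc (2 * r)) S
      (s≤s (≤-reflexive (trans (cong (λ t → rank (IAS G) S + rank (IAS G) (∁ S) ∸ t) (rankM-IAS G)) (cylinder-λ rS r∁S))))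
      (large p rS) (large q r∁S))
    where
    r = cutrank G X
    open Arithmetic {# X} {# (not ∘ X)} (#-∁ X) r
    S = tabulate (X ∘ vertexOf)
    rS : rank (IAS G) S ≡ # X + r
    rS = rank-cylinder G X S (lookup∘tabulate (X ∘ vertexOf))
    r∁S : rank (IAS G) (∁ S) ≡ # (not ∘ X) + r
    r∁S = trans (rank-cylinder G (not ∘ X) (∁ S) (λ e → trans (lookup-∁ S e) (cong not (lookup∘tabulate (X ∘ vertexOf) e))))
                (cong (# (not ∘ X) +_) (cutrank-∁ G sy X))

  -- X is the majority set of S. Then S spans the cylinder over X and W - S spans the cylinder over
  -- V - X, so neither rank increases when S is replaced by the cylinder.
  separation-cutrank : ∀ k S → connλ (IAS G) S < k → k ≤ rank (IAS G) S → k ≤ rank (IAS G) (∁ S) →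
    ∃ λ X → (cutrank G X < # X) × (cutrank G X < # (not ∘ X)) × (suc (2 * cutrank G X) ≤ k)
  separation-cutrank k S conn k≤s k≤t = X , r<x X≤ ∁X≤ conn′ k≤s , r<y X≤ ∁X≤ conn′ k≤t , 1+2r≤k X≤ ∁X≤ conn′
    where
    X = majoritySet (lookup S)
    open Arithmetic {# X} {# (not ∘ X)} (#-∁ X) (cutrank G X)
    X≤ : # X + cutrank G X ≤ rank (IAS G) S
    X≤ = majority-rank G S X (λ _ p → p)
    ∁-majority : ∀ v → majoritySet (lookup (∁ S)) v ≡ not (X v)
    ∁-majority v rewrite lookup-∁ S (φ v) | lookup-∁ S (χ v) | lookup-∁ S (ψ v) =
      sym (not-majority (lookup S (φ v)) (lookup S (χ v)) (lookup S (ψ v)))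
    ∁X≤ : # (not ∘ X) + cutrank G X ≤ rank (IAS G) (∁ S)
    ∁X≤ = ≤-trans (≤-reflexive (cong (# (not ∘ X) +_) (sym (cutrank-∁ G sy X))))
      (majority-rank G (∁ S) (not ∘ X) (λ v p → trans (∁-majority v) p))
    conn′ : rank (IAS G) S + rank (IAS G) (∁ S) ∸ n < k
    conn′ = ≤-trans (s≤s (≤-reflexive (cong (λ t → rank (IAS G) S + rank (IAS G) (∁ S) ∸ t) (sym (rankM-IAS G))))) conn

  -- Rounding an optimal separation gives 2r + 1 ≤ κ and the cylinder gives κ ≤ 2r + 1. This
  -- equality is the source of the oddness of κ.
  κ<n-cutrank : κ (IAS G) < n →
    ∃ λ X → (cutrank G X < # X) × (cutrank G X < # (not ∘ X)) × (κ (IAS G) ≡ suc (2 * cutrank G X))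
  κ<n-cutrank κ<n = minimal (κ (IAS G)) κ≤cutrank (κ-separation (IAS G) (subst (κ (IAS G) <_) (sym (rankM-IAS G)) κ<n))
    where
    minimal : ∀ k → (∀ X → cutrank G X < # X → cutrank G X < # (not ∘ X) → k ≤ suc (2 * cutrank G X)) →
      hasVerticalSepB (IAS G) k ≡ true →
      ∃ λ X → (cutrank G X < # X) × (cutrank G X < # (not ∘ X)) × (k ≡ suc (2 * cutrank G X))
    minimal k least h =
      let S , conn , k≤s , k≤t = separation-elim (IAS G) k h
          X , p , q , le = separation-cutrank k S conn k≤s k≤t
      in X , p , q , ≤-antisym (least X p q) le

-- Components and splits

module _ {n} (G : Graph n) where

  Separated : (Fin n → Bool) → Set
  Separated X = ∀ v i → X v ≡ true → X i ≡ false → G i v ≡ false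

  -- The block between X and V - X is an outer product, so it has rank at most 1. With `a` and `f`
  -- cut down to the two sides as W₁ and W₂, this is the neighbourhood condition of a split.
  Factors : (Fin n → Bool) → (a f : Fin n → Bool) → Set
  Factors X a f = ∀ v i → X v ≡ true → X i ≡ false → G i v ≡ a v ∧ f i

  cut-entry : ∀ X {v i} → X v ≡ true → X i ≡ false → cut G X v i ≡ G i v
  cut-entry X p q rewrite p | q = refl

  cutrank0⇒separated : ∀ X → cutrank G X ≡ 0 → Separated X
  cutrank0⇒separated X e = go (basis (cut G X) ⊤) e
    where
    go : ∀ {r} → Basis (cut G X) (lookup ⊤) r → r ≡ 0 → Separated X
    go B refl v i p q = trans (sym (cut-entry X p q)) (proj₂ (Basis.spans B v (lookup-⊤ v)) i)

  separated⇒cutrank0 : ∀ X → Separated X → cutrank G X ≡ 0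
  separated⇒cutrank0 X sep = n≤0⇒n≡0 (rank-upper (cut G X) ⊤ (λ ()) (λ v _ → (λ ()) , entry v))
    where
    entry : ∀ v i → cut G X v i ≡ false
    entry v i with X v in p | X i in q
    ... | true | false = sep v i p q
    ... | true | true = refl
    ... | false | true = refl
    ... | false | false = refl

  cutrank≤1⇒factors : ∀ X → cutrank G X ≤ 1 → ∃ λ a → ∃ λ f → Factors X a f
  cutrank≤1⇒factors X = go (basis (cut G X) ⊤)
    where
    go : ∀ {r} → Basis (cut G X) (lookup ⊤) r → r ≤ 1 → ∃ λ a → ∃ λ f → Factors X a f
    go {zero} B _ = (λ _ → false) , (λ _ → false) , λ v i p q →
      trans (sym (cut-entry X p q)) (proj₂ (Basis.spans B v (lookup-⊤ v)) i)
    go {suc zero} B _ = (λ v → proj₁ (Basis.spans B v (lookup-⊤ v)) zero) , cut G X (Basis.elt B zero) , λ v i p q →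
      trans (sym (cut-entry X p q)) (trans (proj₂ (Basis.spans B v (lookup-⊤ v)) i) (xor-identityʳ _))
    go {suc (suc r)} B (s≤s ())

  factors⇒cutrank≤1 : ∀ X a f → Factors X a f → cutrank G X ≤ 1
  factors⇒cutrank≤1 X a f fac = rank-upper (cut G X) ⊤ (λ (_ : Fin 1) i → not (X i) ∧ f i)
    (λ v _ → (λ _ → X v ∧ a v) , λ i → trans (entry v i) (sym (xor-identityʳ _)))
    where
    entry : ∀ v i → cut G X v i ≡ (X v ∧ a v) ∧ (not (X i) ∧ f i)
    entry v i with X v in p | X i in q
    ... | true | false = fac v i p q
    ... | true | true = sym (∧-zeroʳ (a v))
    ... | false | true = refl
    ... | false | false = refl

  Closed : (Fin n → Bool) → Set
  Closed R = ∀ v w → R v ≡ true → Adj G v w → R w ≡ true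

  closed-reach : ∀ R → Closed R → ∀ {u v} → R u ≡ true → Reach G u v → R v ≡ true
  closed-reach R cl p here = p
  closed-reach R cl p (step r a) = cl _ _ (closed-reach R cl p r) a

  record Component (u : Fin n) : Set where
    field
      set       : Fin n → Bool
      self      : set u ≡ true
      reachable : ∀ v → set v ≡ true → Reach G u v
      closed    : Closed set

  component : ∀ u → Component u
  component u = grow n (eqB u) (eqB-refl u) (λ v p → subst (Reach G u) (eqB⇒≡ p) here) (m≤n+m n _)
    where
    -- Each round adds one new vertex, which preserves n ≤ |R| + fuel. When the fuel is exhausted, R
    -- is the whole vertex set and closed for that reason.
    grow : ∀ fuel R → R u ≡ true → (∀ v → R v ≡ true → Reach G u v) → n ≤ # R + fuel → Component u
    grow zero R self rch le = record { set = R ; self = self ; reachable = rch ; closed = λ _ w _ _ → full w refl }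
      where
      full : (λ _ → true) ⊑ R
      full = ⊑-antisym-# (λ _ _ → refl) (≤-trans (≤-reflexive (#-all {n} (λ _ → refl))) (≤-trans le (≤-reflexive (+-identityʳ _))))
    grow (suc fuel) R self rch le with any? (λ v → any? (λ w → (R v ≟ᵇ true) ×-dec (R w ≟ᵇ false) ×-dec (G v w ≟ᵇ true)))
    ... | yes (v , w , p , q , g) = grow fuel (R ∪̇ w) (cong (_∨ eqB u w) self) rch′
            (≤-trans le (≤-reflexive (trans (+-suc (# R) fuel) (cong (_+ fuel) (sym (#-∪̇ R w q))))))
      where
      rch′ : ∀ x → (R ∪̇ w) x ≡ true → Reach G u x
      rch′ x h with x ≟ w
      ... | yes refl = step (rch v p) ((λ { refl → clash p q }) , g)
      ... | no ne with R x in r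
      ...   | true = rch x r
    ... | no none = record { set = R ; self = self ; reachable = rch ; closed = cl }
      where
      cl : Closed R
      cl v w p (_ , g) with R w in q
      ... | true = refl
      ... | false = ⊥-elim (none (v , w , p , q , g))

  module _ (sy : IsGraph G) where

    split⇒cutrank≤1 : Split G → ∃ λ X → (2 ≤ # X) × (2 ≤ # (not ∘ X)) × (cutrank G X ≤ 1)
    split⇒cutrank≤1 s = X , ≤-trans size₁ (≤-reflexive (∣∣≡# V₁)) ,
        ≤-trans size₂ (≤-reflexive (trans (∣∣≡# (∁ V₁)) (#-cong (lookup-∁ V₁)))) ,
        factors⇒cutrank≤1 X (lookup W₁) (lookup W₂) fac
      where
      open Split s
      X = lookup V₁
      fac : Factors X (lookup W₁) (lookup W₂)
      fac v i p q with lookup W₁ v in w₁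
      ... | false = not-true (λ g → nbhd-out v (lookup⇒[]= v V₁ p) (λ h → clash ([]=⇒lookup h) w₁) i
                      (lookup⇒[]= i (∁ V₁) (trans (lookup-∁ V₁ i) (cong not q))) (ne , trans (sy v i) g))
        where
        ne : v ≢ i
        ne refl = clash p q
      ... | true with lookup W₂ i in w₂
      ...   | true = trans (sy i v) (proj₂ (proj₂ (nbhd-in v (lookup⇒[]= v W₁ w₁) i
                       (lookup⇒[]= i (∁ V₁) (trans (lookup-∁ V₁ i) (cong not q)))) (lookup⇒[]= i W₂ w₂)))
      ...   | false = not-true (λ g → clash ([]=⇒lookup (proj₁ (nbhd-in v (lookup⇒[]= v W₁ w₁) i
                       (lookup⇒[]= i (∁ V₁) (trans (lookup-∁ V₁ i) (cong not q)))) (ne , trans (sy v i) g))) w₂)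
        where
        ne : v ≢ i
        ne refl = clash p q

    factors⇒split : ∀ X a f → Factors X a f → 2 ≤ # X → 2 ≤ # (not ∘ X) → Split G
    factors⇒split X a f fac p q = record
      { V₁ = V₁ ; W₁ = W₁ ; W₂ = W₂
      ; W₁⊆V₁ = λ {v} h → lookup⇒[]= v V₁ (trans (lV v) (proj₁ (∧-split (trans (sym (lW₁ v)) ([]=⇒lookup h)))))
      ; W₂⊆V₂ = λ {i} h → lookup⇒[]= i (∁ V₁) (trans (l∁V i) (proj₁ (∧-split (trans (sym (lW₂ i)) ([]=⇒lookup h)))))
      ; size₁ = ≤-trans p (≤-reflexive (sym (trans (∣∣≡# V₁) (#-cong lV))))
      ; size₂ = ≤-trans q (≤-reflexive (sym (trans (∣∣≡# (∁ V₁)) (#-cong l∁V))))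
      ; nbhd-in = λ v v∈ i i∈ →
          let xa = ∧-split {X v} (trans (sym (lW₁ v)) ([]=⇒lookup v∈))
              xi = trans (sym (l∁V i)) ([]=⇒lookup i∈)
              e  = trans (sy v i) (trans (fac v i (proj₁ xa) (not-true⇒false xi)) (cong (_∧ f i) (proj₂ xa)))
          in (λ adj → lookup⇒[]= i W₂ (trans (lW₂ i) (cong₂ _∧_ xi (trans (sym e) (proj₂ adj))))) ,
             (λ i∈W → (λ { refl → clash (proj₁ xa) (not-true⇒false xi) }) ,
                      trans e (proj₂ (∧-split {not (X i)} (trans (sym (lW₂ i)) ([]=⇒lookup i∈W)))))
      ; nbhd-out = λ v v∈ v∉ i i∈ adj →
          let xv = trans (sym (lV v)) ([]=⇒lookup v∈)
              xi = trans (sym (l∁V i)) ([]=⇒lookup i∈)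
              av = proj₁ (∧-split (trans (sym (trans (sy v i) (fac v i xv (not-true⇒false xi)))) (proj₂ adj)))
          in v∉ (lookup⇒[]= v W₁ (trans (lW₁ v) (cong₂ _∧_ xv av)))
      }
      where
      V₁ = tabulate X
      W₁ = tabulate (λ v → X v ∧ a v)
      W₂ = tabulate (λ i → not (X i) ∧ f i)
      lV = lookup∘tabulate X
      lW₁ = lookup∘tabulate (λ v → X v ∧ a v)
      lW₂ = lookup∘tabulate (λ i → not (X i) ∧ f i)
      l∁V : ∀ i → lookup (∁ V₁) i ≡ not (X i)
      l∁V i = trans (lookup-∁ V₁ i) (cong not (lV i))

    separated-∁ : ∀ X → Separated X → Separated (not ∘ X)
    separated-∁ X sep v i p q = trans (sy i v) (sep i v (not-false q) (not-true (λ r → clash p (cong not r))))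
      where
      not-false : ∀ {b} → not b ≡ false → b ≡ true
      not-false {true} _ = refl

    -- All edges leaving X ∪ {v} start at v.
    enlarge-singleton : ∀ X → Separated X → 4 ≤ n → # X ≡ 1 → Split G
    enlarge-singleton X sep 4≤n #X = build (#-witness (not ∘ X) (≤-trans (s≤s z≤n) 3≤∁))
      where
      3≤∁ : 3 ≤ # (not ∘ X)
      3≤∁ = ≤-pred (≤-trans 4≤n (≤-reflexive (trans (sym (#-∁ X)) (cong (_+ # (not ∘ X)) #X))))
      build : (∃ λ v → not (X v) ≡ true) → Split G
      build (v , v∉) = factors⇒split (X ∪̇ v) (λ w → eqB w v) (λ i → G i v) fac
          (≤-reflexive (sym #X′)) (≤-pred (≤-trans (≤-trans 3≤∁ (≤-reflexive (#-∖ (not ∘ X) v v∉))) (s≤s (#-mono sub))))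
        where
        X′ = X ∪̇ v
        #X′ : # X′ ≡ 2
        #X′ = trans (#-∪̇ X v (not-true (λ p → clash v∉ (cong not p)))) (cong suc #X)
        sub : (not ∘ X) ∖ v ⊑ not ∘ X′
        sub i h = trans (cong not (∪̇-≢ X (∖-≢ (not ∘ X) h))) (∖-⊑ (not ∘ X) v i h)
        fac : Factors X′ (λ w → eqB w v) (λ i → G i v)
        fac w i p q with w ≟ v
        ... | yes refl = refl
        ... | no ne = sep w i (trans (sym (∨-identityʳ (X w))) p) (∨-falseˡ q)

    separated⇒split : ∀ X → Separated X → 4 ≤ n → 1 ≤ # X → 1 ≤ # (not ∘ X) → Split G
    separated⇒split X sep 4≤n p q with 2 ≤? # X | 2 ≤? # (not ∘ X)
    ... | yes p₂ | yes q₂ = factors⇒split X (λ _ → false) (λ _ → false) sep p₂ q₂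
    ... | no p₂ | _ = enlarge-singleton X sep 4≤n (≤-antisym (≤-pred (≰⇒> p₂)) p)
    ... | yes _ | no q₂ = enlarge-singleton (not ∘ X) (separated-∁ X sep) 4≤n (≤-antisym (≤-pred (≰⇒> q₂)) q)

    closed⇒separated : ∀ R → Closed R → Separated R
    closed⇒separated R cl v i p q = not-true (λ g → clash (cl v i p ((λ { refl → clash p q }) , trans (sy v i) g)) q)

    separated⇒closed : ∀ X → Separated X → Closed X
    separated⇒closed X sep v w p (_ , g) with true? (X w)
    ... | inj₁ q = q
    ... | inj₂ q = clash (trans (sy w v) g) (sep v w p q)

    connected-or-separated : Connected G ⊎ (∃ λ X → (1 ≤ # X) × (1 ≤ # (not ∘ X)) × Separated X)
    connected-or-separated with any? (λ u → any? (λ v → Component.set (component u) v ≟ᵇ false))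
    ... | yes (u , v , p) = inj₂ (set , #-positive set u self , #-positive (not ∘ set) v (cong not p) , closed⇒separated set closed)
      where open Component (component u)
    ... | no none = inj₁ λ u v → Component.reachable (component u) v (lem u v)
      where
      lem : ∀ u v → Component.set (component u) v ≡ true
      lem u v with true? (Component.set (component u) v)
      ... | inj₁ p = p
      ... | inj₂ p = ⊥-elim (none (u , v , p))

    connected⇒cutrank>0 : Connected G → ∀ X → 1 ≤ # X → 1 ≤ # (not ∘ X) → 1 ≤ cutrank G X
    connected⇒cutrank>0 con X p q = ≰⇒> (λ le → absurd (n≤0⇒n≡0 le))
      where
      absurd : cutrank G X ≢ 0
      absurd e with #-witness X p | #-witness (not ∘ X) q
      ... | u , xu | v , xv = clash xv (cong not (closed-reach X (separated⇒closed X (cutrank0⇒separated X e)) xu (con u v)))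

    separated⇒κ≡1 : ∀ X → 1 ≤ # X → 1 ≤ # (not ∘ X) → Separated X → κ (IAS G) ≡ 1
    separated⇒κ≡1 X p q sep = ≤-antisym κ≤1 (positive (κ (IAS G)) (κ<n-cutrank G sy) κ≤1)
      where
      r≡0 = separated⇒cutrank0 X sep
      κ≤1 : κ (IAS G) ≤ 1
      κ≤1 = ≤-trans (κ≤cutrank G sy X (subst (_< # X) (sym r≡0) p) (subst (_< # (not ∘ X)) (sym r≡0) q))
              (≤-reflexive (cong (λ r → suc (2 * r)) r≡0))
      2≤n : 2 ≤ n
      2≤n = ≤-trans (+-mono-≤ p q) (≤-reflexive (#-∁ X))
      positive : ∀ k → (k < n → ∃ λ X → (cutrank G X < # X) × (cutrank G X < # (not ∘ X)) × (k ≡ suc (2 * cutrank G X))) → k ≤ 1 → 1 ≤ k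
      -- κ = 0 would be less than n and hence equal to some 2r + 1.
      positive zero att le = ⊥-elim (0≢suc (proj₂ (proj₂ (proj₂ (att (≤-trans (s≤s z≤n) 2≤n))))))
        where
        0≢suc : ∀ {m} → 0 ≢ suc m
        0≢suc ()
      positive (suc k) _ _ = s≤s z≤n

    disconnected⇒κ≡1 : ¬ Connected G → κ (IAS G) ≡ 1
    disconnected⇒κ≡1 ¬con = go connected-or-separated
      where
      go : Connected G ⊎ (∃ λ X → (1 ≤ # X) × (1 ≤ # (not ∘ X)) × Separated X) → κ (IAS G) ≡ 1
      go (inj₁ con) = ⊥-elim (¬con con)
      go (inj₂ (X , p , q , sep)) = separated⇒κ≡1 X p q sep

    -- The optimal X has cut-rank r ≥ 1, so κ = 2r + 1 ≥ 3. Both sides have more than r vertices,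
    -- which forces n ≥ 4 and thereby settles the graphs with n ≤ 3.
    connected⇒κ≥3 : Connected G → κ (IAS G) < n → (3 ≤ κ (IAS G)) × (4 ≤ n)
    connected⇒κ≥3 con κ<n =
      let X , p , q , e = κ<n-cutrank G sy κ<n
          r>0 = connected⇒cutrank>0 con X (≤-trans (s≤s z≤n) p) (≤-trans (s≤s z≤n) q)
      in ≤-trans (s≤s (*-monoʳ-≤ 2 r>0)) (≤-reflexive (sym e)) ,
         ≤-trans (+-mono-≤ (≤-trans (s≤s r>0) p) (≤-trans (s≤s r>0) q)) (≤-reflexive (#-∁ X))

    connected-small⇒κ≡n : n ≤ 3 → Connected G → κ (IAS G) ≡ n
    connected-small⇒κ≡n n≤3 con = ≤-antisym (κ≤n G) (≮⇒≥ λ κ<n → <-irrefl refl (≤-trans (proj₂ (connected⇒κ≥3 con κ<n)) n≤3))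

    split⇒κ≤3 : Split G → κ (IAS G) ≤ 3
    split⇒κ≤3 s =
      let X , p , q , r≤1 = split⇒cutrank≤1 s
      in ≤-trans (κ≤cutrank G sy X (≤-trans (s≤s r≤1) p) (≤-trans (s≤s r≤1) q)) (s≤s (*-monoʳ-≤ 2 r≤1))

    split⇒κ≡3 : 4 ≤ n → Connected G → Split G → κ (IAS G) ≡ 3
    split⇒κ≡3 4≤n con s = ≤-antisym (split⇒κ≤3 s) (proj₁ (connected⇒κ≥3 con (≤-trans (s≤s (split⇒κ≤3 s)) 4≤n)))

    -- For cut-rank 1 the strict bounds put two vertices on each side. For cut-rank 0 they guarantee
    -- only one, and a singleton side has to be enlarged, which is where 4 ≤ n enters.
    cutrank≤1⇒split : ∀ X → 4 ≤ n → cutrank G X ≤ 1 → cutrank G X < # X → cutrank G X < # (not ∘ X) → Split G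
    cutrank≤1⇒split X 4≤n r≤1 p q with cutrank G X ≟ℕ 0
    ... | yes e = separated⇒split X (cutrank0⇒separated X e) 4≤n (≤-trans (s≤s z≤n) p) (≤-trans (s≤s z≤n) q)
    ... | no ne = let a , f , fac = cutrank≤1⇒factors X r≤1
                      1≤r = n≢0⇒n>0 ne
                  in factors⇒split X a f fac (≤-trans (s≤s 1≤r) p) (≤-trans (s≤s 1≤r) q)

    prime-κ<n : 4 ≤ n → Prime G → κ (IAS G) < n → Odd (κ (IAS G)) × 5 ≤ κ (IAS G)
    prime-κ<n 4≤n prime κ<n =
      let X , p , q , e = κ<n-cutrank G sy κ<n
          r≥2 = ≰⇒> (λ r≤1 → prime (cutrank≤1⇒split X 4≤n r≤1 p q))
      in (cutrank G X , e) , ≤-trans (s≤s (*-monoʳ-≤ 2 r≥2)) (≤-reflexive (sym e))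

allBool : ∀ k → (Vec Bool k → Bool) → Bool
allBool zero f = f []
allBool (suc k) f = allBool k (λ v → f (true ∷ v)) ∧ allBool k (λ v → f (false ∷ v))

-- Proof by truth table: for a concrete f the hypothesis is `refl`.
tautology : ∀ k f → allBool k f ≡ true → ∀ v → f v ≡ true
tautology zero f h [] = h
tautology (suc k) f h (true ∷ v) = tautology k _ (proj₁ (∧-split h)) v
tautology (suc k) f h (false ∷ v) = tautology k _ (proj₂ (∧-split {allBool k (λ v → f (true ∷ v))} h)) v

-- Words and their weights

-- The word of y lists the pairs (y v , (y • G) v); it is an element of the additive code over GF(4) spanned by the closed neighbourhoods.
supp : ∀ {n} → Graph n → (Fin n → Bool) → Fin n → Bool
supp G y v = y v ∨ (y • G) v

-- A word is taken to be nonzero when its support has a vertex. As `supp G y` contains y, this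
-- excludes exactly y = 0.
MinWeight : ∀ {n} → Graph n → ℕ → Set
MinWeight G w = ∀ y v → supp G y v ≡ true → w ≤ # (supp G y)

module _ {n} (G : Graph n) where

  supp-∈ : ∀ y v → y v ≡ true → supp G y v ≡ true
  supp-∈ y v p = cong (_∨ (y • G) v) p

  supp-zero : ∀ y → (∀ v → y v ≡ false) → ∀ v → supp G y v ≡ false
  supp-zero y h v = cong₂ _∨_ (h v) (⨁-false (λ i → cong (_∧ G i v) (h i)))

  indep-cut-⊑ : ∀ X f → IndepSet (cut G X) f → f ⊑ X
  indep-cut-⊑ X f ind e p with true? (X e)
  ... | inj₁ q = q
  ... | inj₂ q = clash (eqB-refl e) (ind (eqB e) (λ i h → trans (cong f (sym (eqB⇒≡ h))) p)
        (λ i → trans (•-δ (cut G X) e i) (trans (cong (λ b → not (X i) ∧ (b ∧ G i e)) q) (∧-zeroʳ (not (X i))))) e)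

  module _ (sy : IsGraph G) where

    cut-row : ∀ X y → y ⊑ X → ∀ i → X i ≡ false → (y • cut G X) i ≡ (y • G) i
    cut-row X y y⊑X i q = ⨁-cong term
      where
      term : ∀ e → y e ∧ cut G X e i ≡ y e ∧ G e i
      term e with y e in p
      ... | false = refl
      ... | true = trans (cut-entry G X (y⊑X e p) q) (sy i e)

    -- On a row outside X the combination of cut columns is the second bit of the word of y, and on
    -- a row inside X it is zero by padding. With its converse below, this identifies the words
    -- supported in X with the kernel of the cut matrix.
    supp⊑⇒cut-kernel : ∀ X y → supp G y ⊑ X → ∀ i → (y • cut G X) i ≡ false
    supp⊑⇒cut-kernel X y s⊑X i with true? (X i)
    ... | inj₁ q = ⨁-false (λ e → trans (cong (λ b → y e ∧ (not b ∧ (X e ∧ G i e))) q) (∧-zeroʳ (y e)))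
    ... | inj₂ q = trans (cut-row X y (λ e p → s⊑X e (supp-∈ y e p)) i q)
                     (∨-falseʳ {y i} (not-true (λ p → clash (s⊑X i p) q)))

    cut-kernel⇒supp⊑ : ∀ X y → y ⊑ X → (∀ i → (y • cut G X) i ≡ false) → supp G y ⊑ X
    cut-kernel⇒supp⊑ X y y⊑X z i p with true? (X i)
    ... | inj₁ q = q
    ... | inj₂ q = clash p (cong₂ _∨_ (not-true (λ r → clash (y⊑X i r) q)) (trans (sym (cut-row X y y⊑X i q)) (z i)))

    -- A deficient X, with cut-rank r < |X| ≤ n/2, would give κ ≤ 2r + 1 < 2|X| ≤ n.
    κ≡n⇒full-cutrank : κ (IAS G) ≡ n → ∀ X → 2 * # X ≤ n → # X ≤ cutrank G X
    κ≡n⇒full-cutrank e X le with # X ≤? cutrank G X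
    ... | yes p = p
    ... | no p = ⊥-elim (<-irrefl e (≤-trans (s≤s (κ≤cutrank G sy X r<X (≤-trans r<X #X≤∁)))
                   (≤-trans (≤-reflexive (double (cutrank G X))) (≤-trans (*-monoʳ-≤ 2 r<X) le))))
      where
      r<X = ≰⇒> p
      #X≤∁ : # X ≤ # (not ∘ X)
      #X≤∁ = +-cancelˡ-≤ (# X) _ _ (≤-trans (≤-reflexive (cong (# X +_) (sym (+-identityʳ (# X))))) (≤-trans le (≤-reflexive (sym (#-∁ X)))))
      double : ∀ r → suc (suc (2 * r)) ≡ 2 * suc r
      double r = cong suc (sym (+-suc r (r + 0)))

    κ≡n⇒weight : κ (IAS G) ≡ n → ∀ y v → supp G y v ≡ true → n < 2 * # (supp G y)
    κ≡n⇒weight e y v p = ≰⇒> λ le →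
      let X = supp G y
          f , _ , ind , #f = rank-attained (cut G X) ⊤
          -- Full cut-rank makes all columns of X independent, whereas the word supported on X would
          -- be a dependency among them.
          X⊑f = ⊑-antisym-# (indep-cut-⊑ X f ind) (≤-trans (κ≡n⇒full-cutrank e X le) (≤-reflexive (sym #f)))
      in clash p (supp-zero y (ind y (λ i q → X⊑f i (supp-∈ y i q)) (supp⊑⇒cut-kernel X y (λ _ q → q))) v)

⨁-symmetric : ∀ {n} (f : Fin n → Fin n → Bool) → (∀ i j → f i j ≡ f j i) → ⨁ (λ i → ⨁ (f i)) ≡ ⨁ (λ i → f i i)
⨁-symmetric {zero} f h = refl
⨁-symmetric {suc n} f h = begin
  (f zero zero xor A) xor ⨁ (λ i → f (suc i) zero xor ⨁ (λ j → f (suc i) (suc j)))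
    ≡⟨ cong ((f zero zero xor A) xor_) (⨁-xor (λ i → f (suc i) zero) _) ⟩
  (f zero zero xor A) xor (⨁ (λ i → f (suc i) zero) xor ⨁ (λ i → ⨁ (λ j → f (suc i) (suc j))))
    ≡⟨ cong₂ (λ a b → (f zero zero xor A) xor (a xor b)) (⨁-cong (λ i → h (suc i) zero)) (⨁-symmetric (λ i j → f (suc i) (suc j)) (λ i j → h (suc i) (suc j))) ⟩
  (f zero zero xor A) xor (A xor D)   ≡⟨ cancel (f zero zero) A D ⟩
  f zero zero xor D                   ∎
  where
  open ≡-Reasoning
  A = ⨁ (λ j → f zero (suc j))
  D = ⨁ (λ i → f (suc i) (suc i))
  cancel : ∀ a b c → (a xor b) xor (b xor c) ≡ a xor c
  cancel true true true = refl
  cancel true true false = refl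
  cancel true false c = refl
  cancel false true true = refl
  cancel false true false = refl
  cancel false false c = refl

infixl 6 _⊕_
_⊕_ : ∀ {n} → (Fin n → Bool) → (Fin n → Bool) → Fin n → Bool
(y ⊕ z) v = y v xor z v

module _ {n} (G : Graph n) (sy : IsGraph G) where

  -- Since a ∨ b = a + b + ab over GF(2), the parity of the weight is linear in y except for the
  -- quadratic form of the adjacency matrix. That form reduces to its diagonal, so the right-hand
  -- side is linear in y.
  weight-parity : ∀ y → ⨁ (supp G y) ≡ ⨁ (λ v → (y v ∧ not (G v v)) xor (y • G) v)
  weight-parity y = begin
    ⨁ (λ v → y v ∨ (y • G) v)                                     ≡⟨ ⨁-cong (λ v → ∨-xor (y v) ((y • G) v)) ⟩
    ⨁ (λ v → (y v xor (y • G) v) xor (y v ∧ (y • G) v))           ≡⟨ ⨁-xor (λ v → y v xor (y • G) v) (λ v → y v ∧ (y • G) v) ⟩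
    ⨁ (λ v → y v xor (y • G) v) xor ⨁ (λ v → y v ∧ (y • G) v)     ≡⟨ cong (⨁ (λ v → y v xor (y • G) v) xor_) quadratic ⟩
    ⨁ (λ v → y v xor (y • G) v) xor ⨁ (λ v → y v ∧ G v v)         ≡⟨ sym (⨁-xor (λ v → y v xor (y • G) v) (λ v → y v ∧ G v v)) ⟩
    ⨁ (λ v → (y v xor (y • G) v) xor (y v ∧ G v v))               ≡⟨ ⨁-cong (λ v → regroup (y v) ((y • G) v) (G v v)) ⟩
    ⨁ (λ v → (y v ∧ not (G v v)) xor (y • G) v)                   ∎
    where
    open ≡-Reasoning
    ∨-xor : ∀ a b → a ∨ b ≡ (a xor b) xor (a ∧ b)
    ∨-xor true true = refl
    ∨-xor true false = refl
    ∨-xor false true = refl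
    ∨-xor false false = refl
    regroup : ∀ a b g → (a xor b) xor (a ∧ g) ≡ (a ∧ not g) xor b
    regroup true true true = refl
    regroup true true false = refl
    regroup true false true = refl
    regroup true false false = refl
    regroup false b g = xor-identityʳ b
    -- The off-diagonal terms of the quadratic form cancel in pairs.
    quadratic : ⨁ (λ v → y v ∧ (y • G) v) ≡ ⨁ (λ v → y v ∧ G v v)
    quadratic = begin
      ⨁ (λ v → y v ∧ ⨁ (λ i → y i ∧ G i v))     ≡⟨ ⨁-cong (λ v → ⨁-∧ˡ (y v) (λ i → y i ∧ G i v)) ⟩
      ⨁ (λ v → ⨁ (λ i → y v ∧ (y i ∧ G i v)))   ≡⟨ ⨁-symmetric (λ v i → y v ∧ (y i ∧ G i v)) symmetric ⟩
      ⨁ (λ v → y v ∧ (y v ∧ G v v))             ≡⟨ ⨁-cong (λ v → idem (y v) (G v v)) ⟩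
      ⨁ (λ v → y v ∧ G v v)                     ∎
      where
      symmetric : ∀ v i → y v ∧ (y i ∧ G i v) ≡ y i ∧ (y v ∧ G v i)
      symmetric v i rewrite sy i v with y v | y i
      ... | true | true = refl
      ... | true | false = refl
      ... | false | true = refl
      ... | false | false = refl
      idem : ∀ a b → a ∧ (a ∧ b) ≡ a ∧ b
      idem true b = refl
      idem false b = refl

  weight-parity-⊕ : ∀ y z → ⨁ (supp G (y ⊕ z)) ≡ ⨁ (supp G y) xor ⨁ (supp G z)
  weight-parity-⊕ y z = begin
    ⨁ (supp G (y ⊕ z))                            ≡⟨ weight-parity (y ⊕ z) ⟩
    ⨁ (λ v → ((y ⊕ z) v ∧ not (G v v)) xor ((y ⊕ z) • G) v)
      ≡⟨ ⨁-cong (λ v → trans (cong₂ _xor_ (∧-distribʳ-xor (not (G v v)) (y v) (z v)) (•-xor y z G v)) (xor-interchange (y v ∧ not (G v v)) _ _ _)) ⟩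
    ⨁ (λ v → form y v xor form z v)               ≡⟨ ⨁-xor (form y) (form z) ⟩
    ⨁ (form y) xor ⨁ (form z)                     ≡⟨ sym (cong₂ _xor_ (weight-parity y) (weight-parity z)) ⟩
    ⨁ (supp G y) xor ⨁ (supp G z)                 ∎
    where
    open ≡-Reasoning
    form : (Fin n → Bool) → Fin n → Bool
    form y v = (y v ∧ not (G v v)) xor (y • G) v

module _ {n} (G : Graph n) where

  supp-⊕ : ∀ y z v → supp G (y ⊕ z) v ≡ (y v xor z v) ∨ ((y • G) v xor (z • G) v)
  supp-⊕ y z v = cong ((y v xor z v) ∨_) (•-xor y z G v)

  supp-⊕-⊑ : ∀ {T} y z → supp G y ⊑ T → supp G z ⊑ T → supp G (y ⊕ z) ⊑ T
  supp-⊕-⊑ {T} y z p q v h with true? (supp G y v) | true? (supp G z v)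
  ... | inj₁ r | _ = p v r
  ... | inj₂ _ | inj₁ r = q v r
  ... | inj₂ r | inj₂ s = clash h (trans (supp-⊕ y z v)
        (cong₂ _∨_ (cong₂ _xor_ (∨-falseˡ {y v} r) (∨-falseˡ {z v} s)) (cong₂ _xor_ (∨-falseʳ {y v} r) (∨-falseʳ {z v} s))))

  supp-⊕-∉ : ∀ y z v → supp G y v ≡ false → supp G (y ⊕ z) v ≡ supp G z v
  supp-⊕-∉ y z v r = trans (supp-⊕ y z v) (cong₂ (λ a b → (a xor z v) ∨ (b xor (z • G) v)) (∨-falseˡ {y v} r) (∨-falseʳ {y v} r))

-- Excluding seven or more vertices.

no-four-values : ∀ a₁ b₁ a₂ b₂ a₃ b₃ a₄ b₄ →
  a₁ ∨ b₁ ≡ true → a₂ ∨ b₂ ≡ true → a₃ ∨ b₃ ≡ true → a₄ ∨ b₄ ≡ true →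
  (a₁ xor a₂) ∨ (b₁ xor b₂) ≡ true → (a₁ xor a₃) ∨ (b₁ xor b₃) ≡ true → (a₁ xor a₄) ∨ (b₁ xor b₄) ≡ true →
  (a₂ xor a₃) ∨ (b₂ xor b₃) ≡ true → (a₂ xor a₄) ∨ (b₂ xor b₄) ≡ true → (a₃ xor a₄) ∨ (b₃ xor b₄) ≡ true → ⊥
no-four-values a₁ b₁ a₂ b₂ a₃ b₃ a₄ b₄ h₁ h₂ h₃ h₄ h₁₂ h₁₃ h₁₄ h₂₃ h₂₄ h₃₄ =
  clash (tautology 8 (λ { (a₁ ∷ b₁ ∷ a₂ ∷ b₂ ∷ a₃ ∷ b₃ ∷ a₄ ∷ b₄ ∷ []) → not (conditions a₁ b₁ a₂ b₂ a₃ b₃ a₄ b₄) }) refl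
           (a₁ ∷ b₁ ∷ a₂ ∷ b₂ ∷ a₃ ∷ b₃ ∷ a₄ ∷ b₄ ∷ []))
        (cong not (cong₂ _∧_ h₁ (cong₂ _∧_ h₂ (cong₂ _∧_ h₃ (cong₂ _∧_ h₄ (cong₂ _∧_ h₁₂ (cong₂ _∧_ h₁₃
          (cong₂ _∧_ h₁₄ (cong₂ _∧_ h₂₃ (cong₂ _∧_ h₂₄ h₃₄))))))))))
  where
  conditions : (a₁ b₁ a₂ b₂ a₃ b₃ a₄ b₄ : Bool) → Bool
  conditions a₁ b₁ a₂ b₂ a₃ b₃ a₄ b₄ =
    (a₁ ∨ b₁) ∧ (a₂ ∨ b₂) ∧ (a₃ ∨ b₃) ∧ (a₄ ∨ b₄) ∧
    ((a₁ xor a₂) ∨ (b₁ xor b₂)) ∧ ((a₁ xor a₃) ∨ (b₁ xor b₃)) ∧ ((a₁ xor a₄) ∨ (b₁ xor b₄)) ∧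
    ((a₂ xor a₃) ∨ (b₂ xor b₃)) ∧ ((a₂ xor a₄) ∨ (b₂ xor b₄)) ∧ ((a₃ xor a₄) ∨ (b₃ xor b₄))

-- Cramer's rule for a 2 × 2 system of determinant 1; over GF(2) signs disappear.
cramer : ∀ a b a′ b′ α β → (a ∧ b′) xor (a′ ∧ b) ≡ true →
  ∃ λ s → ∃ λ t → ((s ∧ a) xor (t ∧ a′) ≡ α) × ((s ∧ b) xor (t ∧ b′) ≡ β)
cramer a b a′ b′ α β h = s , t , xor-≡ (not-true⇒false (proj₁ both)) , xor-≡ (not-true⇒false (proj₂ both))
  where
  s = (α ∧ b′) xor (β ∧ a′)
  t = (a ∧ β) xor (b ∧ α)
  check : Vec Bool 6 → Bool
  check (a ∷ b ∷ a′ ∷ b′ ∷ α ∷ β ∷ []) = not ((a ∧ b′) xor (a′ ∧ b)) ∨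
    (not (((((α ∧ b′) xor (β ∧ a′)) ∧ a) xor (((a ∧ β) xor (b ∧ α)) ∧ a′)) xor α) ∧
     not (((((α ∧ b′) xor (β ∧ a′)) ∧ b) xor (((a ∧ β) xor (b ∧ α)) ∧ b′)) xor β))
  both = ∧-split (trans (cong (λ d → not d ∨ (not ((((s ∧ a) xor (t ∧ a′))) xor α) ∧ not (((s ∧ b) xor (t ∧ b′)) xor β))) (sym h))
                        (tautology 6 check refl (a ∷ b ∷ a′ ∷ b′ ∷ α ∷ β ∷ [])))

-- Dependent nonzero vectors over GF(2) coincide, 1 being the only nonzero scalar.
parallel⇒equal : ∀ a b a′ b′ → a ∨ b ≡ true → a′ ∨ b′ ≡ true → (a ∧ b′) xor (a′ ∧ b) ≡ false →
  (a xor a′) ∨ (b xor b′) ≡ false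
parallel⇒equal true true true true _ _ _ = refl
parallel⇒equal true true true false _ _ ()
parallel⇒equal true true false false _ () _
parallel⇒equal true false true true _ _ ()
parallel⇒equal true false false true _ _ ()
parallel⇒equal true false true false _ _ _ = refl
parallel⇒equal false true false true _ _ _ = refl

-- The hypothesis is a minimum weight and not κ = n, because it must also hold for a graph of even
-- order with one vertex deleted.
module OddOrder {n} (G : Graph n) (sy : IsGraph G) (m : ℕ) (n≡2m+1 : n ≡ suc (2 * m)) (mw : MinWeight G (suc m)) where

  #-∁-suc : ∀ X → # X ≡ suc m → # (not ∘ X) ≡ m
  #-∁-suc X p = +-cancelˡ-≡ (suc m) _ _ (trans (cong (_+ # (not ∘ X)) (sym p)) (trans (#-∁ X)
                  (trans n≡2m+1 (cong (λ t → suc (m + t)) (+-identityʳ m)))))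

  -- The block between the m + 1 vertices of X and the m others has a nonzero kernel vector; its
  -- word is supported in X, and the minimum weight makes it fill X.
  word-on : ∀ X → # X ≡ suc m → ∃ λ y → (supp G y ⊑ X) × (X ⊑ supp G y)
  word-on X p = y , s⊑X , ⊑-antisym-# s⊑X (≤-trans (≤-reflexive p) (mw y e₀ (supp-∈ G y e₀ nonzero)))
    where
    module I = Enumeration (enumerate X)
    module O = Enumeration (enumerate (not ∘ X))
    M : Fin (# X) → Fin (# (not ∘ X)) → Bool
    M j l = G (I.enum j) (O.enum l)
    kernel = nonzero-kernel M (≤-reflexive (trans (cong suc (#-∁-suc X p)) (sym p)))
    x = proj₁ kernel
    j₀ = proj₁ (proj₁ (proj₂ kernel))
    e₀ = I.enum j₀
    y = spread (enumerate X) x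
    nonzero : y e₀ ≡ true
    nonzero = trans (spread-enum (enumerate X) x j₀) (proj₂ (proj₁ (proj₂ kernel)))
    s⊑X : supp G y ⊑ X
    s⊑X v h with true? (X v)
    ... | inj₁ q = q
    ... | inj₂ q with O.index v (cong not q)
    ...   | l , refl = clash h (cong₂ _∨_ (spread-∉ (enumerate X) x v q)
              (trans (spread-• (enumerate X) G x v) (proj₂ (proj₂ kernel) l)))

  -- By symmetry of the cut-rank an (m+1)-set has cut-rank m.
  word-unique : ∀ X → # X ≡ suc m → ∃ λ i → ∀ y → supp G y ⊑ X → y i ≡ false → ∀ v → y v ≡ false
  word-unique X p = i , λ y s⊑X yi → ind y (λ v q → X∖i⊑f v (∖-∈ X (s⊑X v (supp-∈ G y v q)) (λ { refl → clash q yi })))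
                          (supp⊑⇒cut-kernel G sy X y s⊑X)
    where
    #∁ = #-∁-suc X p
    -- A dependency would be a nonzero word on only m vertices.
    complement-indep : IndepSet (cut G (not ∘ X)) (not ∘ X)
    complement-indep y y⊑ z e = not-true λ q → <-irrefl refl (≤-trans (mw y e (supp-∈ G y e q))
      (≤-trans (#-mono (cut-kernel⇒supp⊑ G sy (not ∘ X) y y⊑ z)) (≤-reflexive #∁)))
    m≤r : m ≤ cutrank G X
    m≤r = ≤-trans (≤-reflexive (sym #∁)) (≤-trans (rank-lower (cut G (not ∘ X)) ⊤ (not ∘ X) (λ e _ → lookup-⊤ e) complement-indep)
            (≤-reflexive (cutrank-∁ G sy X)))
    attained = rank-attained (cut G X) ⊤
    f = proj₁ attained
    ind = proj₁ (proj₂ (proj₂ attained))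
    m≤#f : m ≤ # f
    m≤#f = ≤-trans m≤r (≤-reflexive (sym (proj₂ (proj₂ (proj₂ attained)))))
    f⊑X = indep-cut-⊑ G X f ind
    -- The independent set f omits at most one of the m + 1 elements of X. If it omits none, any
    -- element of X serves as i.
    exceptional : ∃ λ i → X ∖ i ⊑ f
    exceptional with any? (λ i → (X i ≟ᵇ true) ×-dec (f i ≟ᵇ false))
    ... | no none = proj₁ (#-witness X (≤-trans (s≤s z≤n) (≤-reflexive (sym p)))) , λ v h → lem v (∖-⊑ X _ v h)
      where
      lem : X ⊑ f
      lem v h with true? (f v)
      ... | inj₁ q = q
      ... | inj₂ q = ⊥-elim (none (v , h , q))
    ... | yes (i , xi , fi) = i , ⊑-antisym-# (λ v h → ∖-∈ X (f⊑X v h) (λ { refl → clash h fi }))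
            (≤-trans (≤-reflexive (suc-injective (trans (sym (#-∖ X i xi)) p))) m≤#f)
    i = proj₁ exceptional
    X∖i⊑f = proj₂ exceptional

  module _ (T : Fin n → Bool) (#T : # T ≡ suc (suc m)) where

    #T∖ : ∀ {i} → T i ≡ true → # (T ∖ i) ≡ suc m
    #T∖ {i} p = suc-injective (trans (sym (#-∖ T i p)) #T)

    abstract
      word : ∀ {i} → T i ≡ true → Fin n → Bool
      word {i} p = proj₁ (word-on (T ∖ i) (#T∖ p))

      word-⊑ : ∀ {i} (p : T i ≡ true) → supp G (word p) ⊑ T ∖ i
      word-⊑ {i} p = proj₁ (proj₂ (word-on (T ∖ i) (#T∖ p)))

      word-⊒ : ∀ {i} (p : T i ≡ true) → T ∖ i ⊑ supp G (word p)
      word-⊒ {i} p = proj₂ (proj₂ (word-on (T ∖ i) (#T∖ p)))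

    word-∈ : ∀ {i j} (p : T i ≡ true) → T j ≡ true → j ≢ i → supp G (word p) j ≡ true
    word-∈ p q ne = word-⊒ p _ (∖-∈ T q ne)

    word-∉ : ∀ {i} (p : T i ≡ true) → supp G (word p) i ≡ false
    word-∉ {i} p = not-true (λ h → clash (word-⊑ p i h) (∖-self T i))

    word-odd : ∀ {i} (p : T i ≡ true) → ⨁ (supp G (word p)) ≡ odd (suc m)
    word-odd {i} p = trans (⨁-odd (supp G (word p))) (cong odd (trans (≤-antisym (#-mono (word-⊑ p))
      (#-mono (word-⊒ p))) (#T∖ p)))

    sum-nonzero : ∀ {i j} (p : T i ≡ true) (q : T j ≡ true) → i ≢ j → supp G (word p ⊕ word q) i ≡ true
    sum-nonzero p q ne = trans (supp-⊕-∉ G (word p) (word q) _ (word-∉ p)) (word-∈ q p ne)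

    sum-⊑ : ∀ {i j} (p : T i ≡ true) (q : T j ≡ true) → supp G (word p ⊕ word q) ⊑ T
    sum-⊑ p q = supp-⊕-⊑ G (word p) (word q) (λ v h → ∖-⊑ T _ v (word-⊑ p v h)) (λ v h → ∖-⊑ T _ v (word-⊑ q v h))

    sum-even : ∀ {i j} (p : T i ≡ true) (q : T j ≡ true) → ⨁ (supp G (word p ⊕ word q)) ≡ false
    sum-even p q = trans (weight-parity-⊕ G sy (word p) (word q)) (trans (cong₂ _xor_ (word-odd p) (word-odd q)) (xor-same (odd (suc m))))

    -- For even m the sum of two words has even weight, hence weight m + 2.
    sum-full : odd m ≡ false → ∀ {i j} (p : T i ≡ true) (q : T j ≡ true) → i ≢ j → T ⊑ supp G (word p ⊕ word q)
    sum-full even {i} p q ne = ⊑-antisym-# (sum-⊑ p q) (≤-trans (≤-reflexive #T) m+2≤)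
      where
      w = # (supp G (word p ⊕ word q))
      m+2≤ : suc (suc m) ≤ w
      m+2≤ with m≤n⇒m<n∨m≡n (mw (word p ⊕ word q) i (sum-nonzero p q ne))
      ... | inj₁ lt = lt
      ... | inj₂ eq = clash (cong not even) (trans (cong odd eq) (trans (sym (⨁-odd (supp G (word p ⊕ word q)))) (sum-even p q)))

    no-five-elements : odd m ≡ false → ∀ {i₀ i₁ i₂ i₃ i₄} →
      T i₀ ≡ true → T i₁ ≡ true → T i₂ ≡ true → T i₃ ≡ true → T i₄ ≡ true →
      i₀ ≢ i₁ → i₀ ≢ i₂ → i₀ ≢ i₃ → i₀ ≢ i₄ → i₁ ≢ i₂ → i₁ ≢ i₃ → i₁ ≢ i₄ → i₂ ≢ i₃ → i₂ ≢ i₄ → i₃ ≢ i₄ → ⊥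
    no-five-elements even {i₀} p₀ p₁ p₂ p₃ p₄ n₀₁ n₀₂ n₀₃ n₀₄ n₁₂ n₁₃ n₁₄ n₂₃ n₂₄ n₃₄ =
      no-four-values (word p₁ i₀) ((word p₁ • G) i₀) (word p₂ i₀) ((word p₂ • G) i₀)
        (word p₃ i₀) ((word p₃ • G) i₀) (word p₄ i₀) ((word p₄ • G) i₀)
        (word-∈ p₁ p₀ n₀₁) (word-∈ p₂ p₀ n₀₂) (word-∈ p₃ p₀ n₀₃) (word-∈ p₄ p₀ n₀₄)
        (differ p₁ p₂ n₁₂) (differ p₁ p₃ n₁₃) (differ p₁ p₄ n₁₄) (differ p₂ p₃ n₂₃) (differ p₂ p₄ n₂₄) (differ p₃ p₄ n₃₄)
      where
      differ : ∀ {i j} (p : T i ≡ true) (q : T j ≡ true) → i ≢ j →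
        (word p i₀ xor word q i₀) ∨ ((word p • G) i₀ xor (word q • G) i₀) ≡ true
      differ p q ne = trans (sym (supp-⊕ G (word p) (word q) i₀)) (sum-full even p q ne i₀ p₀)

    EvenWord : (Fin n → Bool) → Set
    EvenWord y = (supp G y ⊑ T) × (⨁ (supp G y) ≡ false)

    even-scale : ∀ s y → EvenWord y → EvenWord (λ v → s ∧ y v)
    even-scale true y h = h
    even-scale false y h = (λ v p → clash p (zero-word v)) , ⨁-false zero-word
      where zero-word = supp-zero G (λ _ → false) (λ _ → refl)

    even-⊕ : ∀ y z → EvenWord y → EvenWord z → EvenWord (y ⊕ z)
    even-⊕ y z (p , e) (q , f) = supp-⊕-⊑ G y z p q , trans (weight-parity-⊕ G sy y z) (cong₂ _xor_ e f)

    -- Two of the three words take different nonzero values at i: otherwise their pairwise sums would be distinct words on T ∖ i.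
    even-words-surject : odd m ≡ true → ∀ {i j₁ j₂ j₃} → T i ≡ true → T j₁ ≡ true → T j₂ ≡ true → T j₃ ≡ true →
      i ≢ j₁ → i ≢ j₂ → i ≢ j₃ → j₁ ≢ j₂ → j₁ ≢ j₃ → j₂ ≢ j₃ →
      ∀ α β → ∃ λ y → EvenWord y × (y i ≡ α) × ((y • G) i ≡ β)
    even-words-surject oddm {i} {j₁} {j₂} {j₃} p p₁ p₂ p₃ n₁ n₂ n₃ n₁₂ n₁₃ n₂₃ α β =
      -- If two of the words have independent values at i, as vectors over GF(2), their combinations
      -- realise every value (α, β) there.
      choose (true? (det (word p₁) (word p₂))) (true? (det (word p₁) (word p₃)))
      where
      det : (Fin n → Bool) → (Fin n → Bool) → Bool
      det y z = (y i ∧ (z • G) i) xor (z i ∧ (y • G) i)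
      word-even : ∀ {j} (q : T j ≡ true) → EvenWord (word q)
      word-even q = (λ v h → ∖-⊑ T _ v (word-⊑ q v h)) , trans (word-odd q) (cong not oddm)
      combination : ∀ {j k} (q : T j ≡ true) (r : T k ≡ true) → det (word q) (word r) ≡ true →
        ∃ λ y → EvenWord y × (y i ≡ α) × ((y • G) i ≡ β)
      combination q r d with cramer (word q i) ((word q • G) i) (word r i) ((word r • G) i) α β d
      ... | s , t , eα , eβ = y₁ ⊕ y₂ , even-⊕ y₁ y₂ (even-scale s (word q) (word-even q)) (even-scale t (word r) (word-even r)) , eα ,
              trans (•-xor y₁ y₂ G i) (trans (cong₂ _xor_ (•-scale s (word q) G i) (•-scale t (word r) G i)) eβ)
        where
        y₁ = λ v → s ∧ word q v
        y₂ = λ v → t ∧ word r v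
      sum-on-T∖i : ∀ {j k} (q : T j ≡ true) (r : T k ≡ true) → i ≢ j → i ≢ k → det (word q) (word r) ≡ false →
        supp G (word q ⊕ word r) ⊑ T ∖ i
      sum-on-T∖i q r ij ik d v h = ∖-∈ T (sum-⊑ q r v h) λ { refl → clash h (trans (supp-⊕ G (word q) (word r) i)
        (parallel⇒equal (word q i) ((word q • G) i) (word r i) ((word r • G) i) (word-∈ q p ij) (word-∈ r p ik) d)) }
      absurd : det (word p₁) (word p₂) ≡ false → det (word p₁) (word p₃) ≡ false → ⊥
      absurd d₁₂ d₁₃ = clash (sum-nonzero p₂ p₃ n₂₃) (supp-zero G (word p₂ ⊕ word p₃) vanishes j₂)
        where
        U = word-unique (T ∖ i) (#T∖ p)
        c = proj₁ U
        -- A nonzero word on T - i is nonzero at the distinguished vertex c of that set. Two such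
        -- words therefore cancel at c, and by uniqueness everywhere.
        at-c : ∀ {k} (r : T k ≡ true) → j₁ ≢ k → supp G (word p₁ ⊕ word r) ⊑ T ∖ i → (word p₁ ⊕ word r) c ≡ true
        at-c r ne sub with true? ((word p₁ ⊕ word r) c)
        ... | inj₁ h = h
        ... | inj₂ h = clash (sum-nonzero p₁ r ne) (supp-zero G (word p₁ ⊕ word r) (proj₂ U _ sub h) j₁)
        s₁₂ = sum-on-T∖i p₁ p₂ n₁ n₂ d₁₂
        s₁₃ = sum-on-T∖i p₁ p₃ n₁ n₃ d₁₃
        telescope : ∀ a b c → (a xor b) xor (a xor c) ≡ b xor c
        telescope true true true = refl
        telescope true true false = refl
        telescope true false true = refl
        telescope true false false = refl
        telescope false b c = refl
        z = (word p₁ ⊕ word p₂) ⊕ (word p₁ ⊕ word p₃)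
        z≡0 : ∀ v → z v ≡ false
        z≡0 = proj₂ U z (supp-⊕-⊑ G (word p₁ ⊕ word p₂) (word p₁ ⊕ word p₃) s₁₂ s₁₃)
                (cong₂ _xor_ (at-c p₂ n₁₂ s₁₂) (at-c p₃ n₁₃ s₁₃))
        vanishes : ∀ v → (word p₂ ⊕ word p₃) v ≡ false
        vanishes v = trans (sym (telescope (word p₁ v) (word p₂ v) (word p₃ v))) (z≡0 v)
      choose : (det (word p₁) (word p₂) ≡ true) ⊎ (det (word p₁) (word p₂) ≡ false) →
        (det (word p₁) (word p₃) ≡ true) ⊎ (det (word p₁) (word p₃) ≡ false) →
        ∃ λ y → EvenWord y × (y i ≡ α) × ((y • G) i ≡ β)
      choose (inj₁ d) _ = combination p₁ p₂ d
      choose (inj₂ _) (inj₁ d) = combination p₁ p₃ d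
      choose (inj₂ d₁₂) (inj₂ d₁₃) = ⊥-elim (absurd d₁₂ d₁₃)

  even-m-bound : odd m ≡ false → 3 ≤ m → ⊥
  even-m-bound even (s≤s (s≤s (s≤s {n = k} z≤n))) = from (subset-of-size (λ _ → true) (suc (suc m)) (≤-trans m+2≤n (≤-reflexive (sym (#-all {n} (λ _ → refl))))))
    where
    m+2≤n : suc (suc m) ≤ n
    m+2≤n = ≤-trans (s≤s (≤-trans (≤-reflexive (+-comm 1 m)) (+-monoʳ-≤ m (s≤s z≤n)))) (≤-reflexive (sym n≡2m+1))
    from : (∃ λ T → (T ⊑ (λ _ → true)) × (# T ≡ suc (suc m))) → ⊥
    from (T , _ , #T) = no-five-elements T #T even (enum-∈ 0F) (enum-∈ 1F) (enum-∈ 2F) (enum-∈ 3F) (enum-∈ 4F)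
        (ne λ ()) (ne λ ()) (ne λ ()) (ne λ ()) (ne λ ()) (ne λ ()) (ne λ ()) (ne λ ()) (ne λ ()) (ne λ ())
      where
      E : Enumeration T (suc (suc m))
      -- As m ≥ 3, the set T has m + 2 ≥ 5 elements: one coordinate to inspect and four to omit.
      E = subst (Enumeration T) #T (enumerate T)
      open Enumeration E
      ne : ∀ {i j} → i ≢ j → enum i ≢ enum j
      ne h e = h (enum-inj e)

  module _ (oddm : odd m ≡ true) (3≤m : 3 ≤ m) where

    -- Cancelling one coordinate of a heavy word by an even word on m + 2 coordinates of its support.
    reduce : ∀ y → suc (suc m) ≤ # (supp G y) →
      ∃ λ z → (# (supp G z) < # (supp G y)) × (⨁ (supp G z) ≡ ⨁ (supp G y))
    reduce y le = on-subset (subset-of-size (supp G y) (suc (suc m)) le)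
      where
      Reduced : Set
      Reduced = ∃ λ z → (# (supp G z) < # (supp G y)) × (⨁ (supp G z) ≡ ⨁ (supp G y))
      module _ {T} (T⊑ : T ⊑ supp G y) (#T : # T ≡ suc (suc m)) {i} (p : T i ≡ true) where
        three : ∀ {k} → 3 ≤ k → Enumeration (T ∖ i) k → ∃ λ z → EvenWord T #T z × (z i ≡ y i) × ((z • G) i ≡ (y • G) i)
        three (s≤s (s≤s (s≤s z≤n))) E = even-words-surject T #T oddm p (∈T 0F) (∈T 1F) (∈T 2F) (≢i 0F) (≢i 1F) (≢i 2F)
            (ne λ ()) (ne λ ()) (ne λ ()) (y i) ((y • G) i)
          where
          open Enumeration E
          ∈T : ∀ j → T (enum j) ≡ true
          ∈T j = ∖-⊑ T i (enum j) (enum-∈ j)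
          ≢i : ∀ j → i ≢ enum j
          ≢i j e = ∖-≢ T (enum-∈ j) (sym e)
          ne : ∀ {j k} → j ≢ k → enum j ≢ enum k
          ne h e = h (enum-inj e)
        cancel : (∃ λ z → EvenWord T #T z × (z i ≡ y i) × ((z • G) i ≡ (y • G) i)) → Reduced
        cancel (z , (z⊑T , z-even) , e₁ , e₂) =
            y ⊕ z , ≤-trans (s≤s (#-mono smaller)) (≤-reflexive (sym (#-∖ (supp G y) i (T⊑ i p)))) ,
            trans (weight-parity-⊕ G sy y z) (trans (cong (⨁ (supp G y) xor_) z-even) (xor-identityʳ _))
          where
          vanish : supp G (y ⊕ z) i ≡ false
          vanish = trans (supp-⊕ G y z i) (cong₂ _∨_ (trans (cong (y i xor_) e₁) (xor-same (y i)))
            (trans (cong ((y • G) i xor_) e₂) (xor-same ((y • G) i))))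
          smaller : supp G (y ⊕ z) ⊑ supp G y ∖ i
          smaller v h = ∖-∈ (supp G y) (supp-⊕-⊑ G y z (λ _ q → q) (λ v q → T⊑ v (z⊑T v q)) v h) λ { refl → clash h vanish }
        at-element : Reduced
        at-element = cancel (three (≤-trans 3≤m (≤-trans (m≤n⇒m≤1+n ≤-refl) (≤-reflexive (sym (#T∖ T #T p))))) (enumerate (T ∖ i)))
      on-subset : (∃ λ T → (T ⊑ supp G y) × (# T ≡ suc (suc m))) → Reduced
      on-subset (T , T⊑ , #T) =
        let i , p = #-witness T (≤-trans (s≤s z≤n) (≤-reflexive (sym #T)))
        in at-element T⊑ #T p

    -- The minimum weight leaves only the weights 0 and m + 1, both even when m is odd.
    light-even : ∀ y → ¬ (suc (suc m) ≤ # (supp G y)) → ⨁ (supp G y) ≡ false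
    light-even y light = go (any? (λ v → supp G y v ≟ᵇ true))
      where
      go : Dec (∃ λ v → supp G y v ≡ true) → ⨁ (supp G y) ≡ false
      go (yes (v , p)) = trans (⨁-odd (supp G y)) (trans (cong odd (≤-antisym (≤-pred (≰⇒> light)) (mw y v p))) (cong not oddm))
      go (no none) = ⨁-false (λ v → not-true (λ p → none (v , p)))

    all-even : ∀ N y → # (supp G y) ≤ N → ⨁ (supp G y) ≡ false
    all-even N y le = go N le (suc (suc m) ≤? # (supp G y))
      where
      go : ∀ N → # (supp G y) ≤ N → Dec (suc (suc m) ≤ # (supp G y)) → ⨁ (supp G y) ≡ false
      go _ _ (no light) = light-even y light
      go zero le (yes heavy) = ⊥-elim (1+n≰n (≤-trans (≤-trans (s≤s z≤n) heavy) le))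
      go (suc N) le (yes heavy) =
        let z , lt , same = reduce y heavy
        in trans (sym same) (all-even N z (≤-pred (≤-trans lt le)))

    odd-m-absurd : ⊥
    odd-m-absurd = clash (trans (⨁-odd (supp G ones)) (trans (cong odd (trans (#-all {f = supp G ones} (λ _ → refl)) n≡2m+1)) (odd-suc-double m)))
                         (all-even n ones (≤-reflexive (#-all {f = supp G ones} (λ _ → refl))))
      where
      ones : Fin n → Bool
      ones _ = true
      odd-suc-double : ∀ k → odd (suc (2 * k)) ≡ true
      odd-suc-double zero = refl
      odd-suc-double (suc k) rewrite +-suc k (k + 0) = cong (not ∘ not) (odd-suc-double k)

  order<7 : 3 ≤ m → ⊥
  order<7 3≤m with true? (odd m)
  ... | inj₁ o = odd-m-absurd o 3≤m
  ... | inj₂ e = even-m-bound e 3≤m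

deleteFirst : ∀ {n} → Graph (suc n) → Graph n
deleteFirst G i j = G (suc i) (suc j)

-- Extending y by 0 at the deleted vertex gives a word of G that has the same values elsewhere, so
-- its weight exceeds that of y by at most one.
minWeight-deleteFirst : ∀ {n w} (G : Graph (suc n)) → MinWeight G (suc w) → MinWeight (deleteFirst G) w
minWeight-deleteFirst {n} G mw y v p = ≤-pred (≤-trans (mw y′ (suc v) p) (+-monoˡ-≤ _ (bit≤1 (supp G y′ zero))))
  where
  y′ : Fin (suc n) → Bool
  y′ zero = false
  y′ (suc i) = y i
  bit≤1 : ∀ b → bit b ≤ 1
  bit≤1 true = s≤s z≤n
  bit≤1 false = z≤n

even-or-odd : ∀ n → ∃ λ m → (n ≡ 2 * m) ⊎ (n ≡ suc (2 * m))
even-or-odd zero = 0 , inj₁ refl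
even-or-odd (suc n) with even-or-odd n
... | m , inj₁ e = m , inj₂ (cong suc e)
... | m , inj₂ e = suc m , inj₁ (trans (cong suc e) (cong suc (sym (+-suc m (m + 0)))))

heavy-order<7 : ∀ {n} (G : Graph n) → IsGraph G → 7 ≤ n → (∀ y v → supp G y v ≡ true → n < 2 * # (supp G y)) → ⊥
heavy-order<7 {n} G sy 7≤n heavy with even-or-odd n
... | m , inj₂ refl = OddOrder.order<7 G sy m refl (λ y v p → *-cancelˡ-< 2 m _ (<-≤-trans (s≤s (m≤n⇒m≤1+n ≤-refl)) (heavy y v p)))
                        (*-cancelˡ-≤ 2 (≤-pred 7≤n))
... | zero , inj₁ refl = ⊥-elim (7≰0 7≤n)
  where
  7≰0 : 7 ≤ 0 → ⊥
  7≰0 ()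
-- Here G has 2(m + 1) vertices and minimum weight m + 2; deletion leaves 2m + 1 vertices and
-- minimum weight m + 1.
... | suc m , inj₁ refl = OddOrder.order<7 (deleteFirst G) (λ i j → sy (suc i) (suc j)) m (+-suc m (m + 0))
        (minWeight-deleteFirst G (λ y v p → *-cancelˡ-< 2 (suc m) _ (heavy y v p)))
        (≤-pred (*-cancelˡ-< 2 3 (suc m) 7≤n))

-- Local complementation

-- A loop at v contributes to the second bit at v only if y v = 1, and then v lies in the support
-- anyway.
supp-offdiagonal : ∀ {n} (G H : Graph n) → (∀ i j → i ≢ j → G i j ≡ H i j) → ∀ y → supp G y ≗ supp H y
supp-offdiagonal G H h y v with y v in p
... | true = refl
... | false = ⨁-cong term
  where
  term : ∀ i → y i ∧ G i v ≡ y i ∧ H i v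
  term i with i ≟ v
  ... | no ne = cong (y i ∧_) (h i v ne)
  ... | yes refl rewrite p = refl

minWeight-supp : ∀ {n w} (G H : Graph n) → (∀ y → ∃ λ y′ → supp G y′ ≗ supp H y) → MinWeight G w → MinWeight H w
minWeight-supp G H h mw y v p with h y
... | y′ , e = ≤-trans (mw y′ v (trans (e v) p)) (≤-reflexive (#-cong e))

Loopless : ∀ {n} → Graph n → Set
Loopless G = ∀ v → G v v ≡ false

nbrB-self : ∀ {n} (G : Graph n) v → nbrB G v v ≡ false
nbrB-self G v rewrite eqB-refl v = refl

nbrB-≢ : ∀ {n} (G : Graph n) {v w} → w ≢ v → nbrB G v w ≡ G v w
nbrB-≢ G ne rewrite eqB-≢ ne = refl

simpleLC-sym : ∀ {n} (G : Graph n) → IsGraph G → ∀ v → IsGraph (simpleLC v G)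
simpleLC-sym G sy v i j = cong₂ _xor_ (sy i j) (cong₂ (λ a b → not a ∧ b) (eqB-sym i j) (∧-comm (nbrB G v i) (nbrB G v j)))

simpleLC-loopless : ∀ {n} (G : Graph n) → Loopless G → ∀ v → Loopless (simpleLC v G)
simpleLC-loopless G ll v i rewrite ll i | eqB-refl i = refl

module _ {n} (G : Graph n) (sy : IsGraph G) (v : Fin n) (y : Fin n → Bool) where

  private
    N = nbrB G v

    β : Bool
    β = ⨁ (λ i → y i ∧ N i)

    y′ : Fin n → Bool
    y′ i = y i xor (eqB v i ∧ β)

    -- With N the neighbourhood vector of v, local complementation adds the rank-one matrix N Nᵀ and
    -- removes its diagonal again; these are the two correction terms.
    row-LC : ∀ w → (y • simpleLC v G) w ≡ (y • G) w xor ((β ∧ N w) xor (y w ∧ N w))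
    row-LC w = begin
      ⨁ (λ i → y i ∧ simpleLC v G i w)                                     ≡⟨ ⨁-cong (λ i → expand (y i) (G i w) (eqB i w) (N i) (N w)) ⟩
      ⨁ (λ i → (y i ∧ G i w) xor (both i xor diagonal i))                  ≡⟨ ⨁-xor (λ i → y i ∧ G i w) (λ i → both i xor diagonal i) ⟩
      (y • G) w xor ⨁ (λ i → both i xor diagonal i)                        ≡⟨ cong ((y • G) w xor_) (⨁-xor both diagonal) ⟩
      (y • G) w xor (⨁ both xor ⨁ diagonal)
        ≡⟨ cong ((y • G) w xor_) (cong₂ _xor_ (sym (⨁-∧ʳ (λ i → y i ∧ N i) (N w)))
             (trans (⨁-δ′ (λ i → (y i ∧ N i) ∧ N w) w) (idem (y w) (N w)))) ⟩
      (y • G) w xor ((β ∧ N w) xor (y w ∧ N w))                            ∎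
      where
      open ≡-Reasoning
      both diagonal : Fin n → Bool
      both i = (y i ∧ N i) ∧ N w
      diagonal i = ((y i ∧ N i) ∧ N w) ∧ eqB i w
      expand : ∀ a g e p q → a ∧ (g xor (not e ∧ p ∧ q)) ≡ (a ∧ g) xor (((a ∧ p) ∧ q) xor (((a ∧ p) ∧ q) ∧ e))
      expand false g e p q = refl
      expand true g true p q = cong (g xor_) (sym (trans (cong ((p ∧ q) xor_) (∧-identityʳ (p ∧ q))) (xor-same (p ∧ q))))
      expand true g false p q = cong (g xor_) (sym (trans (cong ((p ∧ q) xor_) (∧-zeroʳ (p ∧ q))) (xor-identityʳ (p ∧ q))))
      idem : ∀ a b → (a ∧ b) ∧ b ≡ a ∧ b
      idem true true = refl
      idem true false = refl
      idem false b = refl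

    row-y′ : ∀ w → (y′ • G) w ≡ (y • G) w xor (β ∧ G v w)
    row-y′ w = trans (•-xor y (λ i → eqB v i ∧ β) G w) (cong ((y • G) w xor_)
      (trans (⨁-cong (λ i → ∧-assoc (eqB v i) β (G i w))) (⨁-δ (λ i → β ∧ G i w) v)))

    row-v : (y • G) v ≡ β xor (y v ∧ G v v)
    row-v = trans (⨁-cong term) (trans (⨁-xor (λ i → y i ∧ N i) (λ i → eqB v i ∧ (y i ∧ G i v)))
              (cong (β xor_) (⨁-δ (λ i → y i ∧ G i v) v)))
      where
      term : ∀ i → y i ∧ G i v ≡ (y i ∧ N i) xor (eqB v i ∧ (y i ∧ G i v))
      term i with v ≟ i
      ... | yes refl rewrite nbrB-self G v | ∧-zeroʳ (y v) = refl
      ... | no ne rewrite nbrB-≢ G (ne ∘ sym) | sy v i = sym (xor-identityʳ _)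

  -- Adding v to y, when y has an odd number of neighbours of v, turns the word of y in the local complement into a word of G with the same support.
  simpleLC-supp : ∃ λ y′ → supp G y′ ≗ supp (simpleLC v G) y
  simpleLC-supp = y′ , same
    where
    -- For fixed g, the pairs of bits on the two sides are related by an invertible linear map of
    -- GF(2)², so they vanish together. The same holds for `off-v`.
    at-v : ∀ a b g → (a xor b) ∨ ((b xor (a ∧ g)) xor (b ∧ g)) ≡ a ∨ ((b xor (a ∧ g)) xor false)
    at-v true true true = refl
    at-v true true false = refl
    at-v true false true = refl
    at-v true false false = refl
    at-v false true true = refl
    at-v false true false = refl
    at-v false false true = refl
    at-v false false false = refl
    off-v : ∀ a c b g → (a xor false) ∨ (c xor (b ∧ g)) ≡ a ∨ (c xor ((b ∧ g) xor (a ∧ g)))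
    off-v true c b g = refl
    off-v false c b g = cong (c xor_) (sym (xor-identityʳ _))
    same : supp G y′ ≗ supp (simpleLC v G) y
    same w with v ≟ w
    ... | yes refl = trans (cong ((y v xor β) ∨_) (trans (row-y′ v) (cong (_xor (β ∧ G v v)) row-v)))
          (trans (at-v (y v) β (G v v)) (cong (y v ∨_) (sym (trans (row-LC v) (cong₂ _xor_ row-v no-neighbour)))))
      where
      no-neighbour : (β ∧ N v) xor (y v ∧ N v) ≡ false
      no-neighbour rewrite nbrB-self G v | ∧-zeroʳ β | ∧-zeroʳ (y v) = refl
    ... | no ne = trans (cong ((y w xor false) ∨_) (row-y′ w)) (trans (off-v (y w) ((y • G) w) β (G v w))
          (cong (y w ∨_) (sym (trans (row-LC w) (cong (λ g → (y • G) w xor ((β ∧ g) xor (y w ∧ g))) (nbrB-≢ G (ne ∘ sym)))))))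

localComplements : ∀ {n} → List (Fin n) → Graph n → Graph n
localComplements [] G = G
localComplements (v ∷ vs) G = localComplements vs (simpleLC v G)

localComplements-equivalent : ∀ {n} vs (G : Graph n) → LocallyEquivalent G (localComplements vs G)
localComplements-equivalent [] G = ε
localComplements-equivalent (v ∷ vs) G = s-step v G ◅ localComplements-equivalent vs (simpleLC v G)

record Simple {n} (G : Graph n) : Set where
  constructor simple
  field
    symmetric : IsGraph G
    loopless  : Loopless G

simpleLC-simple : ∀ {n} {G : Graph n} v → Simple G → Simple (simpleLC v G)
simpleLC-simple {G = G} v (simple sy ll) = simple (simpleLC-sym G sy v) (simpleLC-loopless G ll v)

localComplements-simple : ∀ {n} vs {G : Graph n} → Simple G → Simple (localComplements vs G)
localComplements-simple [] s = s
localComplements-simple (v ∷ vs) s = localComplements-simple vs (simpleLC-simple v s)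

localComplements-minWeight : ∀ {n w} vs {G : Graph n} → Simple G → MinWeight G w → MinWeight (localComplements vs G) w
localComplements-minWeight [] s mw = mw
localComplements-minWeight (v ∷ vs) {G} s mw = localComplements-minWeight vs (simpleLC-simple v s)
  (minWeight-supp G (simpleLC v G) (simpleLC-supp G (Simple.symmetric s) v) mw)

simpleLC-cong : ∀ {n} {G H : Graph n} v → (∀ i → G i ≗ H i) → ∀ i → simpleLC v G i ≗ simpleLC v H i
simpleLC-cong v h i j rewrite h i j | h v i | h v j = refl

localComplements-cong : ∀ {n} vs {G H : Graph n} → (∀ i → G i ≗ H i) → ∀ i → localComplements vs G i ≗ localComplements vs H i
localComplements-cong [] h = h
localComplements-cong (v ∷ vs) h = localComplements-cong vs (simpleLC-cong v h)

unloop : ∀ {n} (G : Graph n) → IsGraph G → ∃ λ H → LocallyEquivalent G H × Simple H × (∀ i j → i ≢ j → G i j ≡ H i j)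
unloop {n} G sy with go (allFin n) G
  where
  go : ∀ vs (G : Graph n) → ∃ λ H → LocallyEquivalent G H × (∀ i j → i ≢ j → G i j ≡ H i j) ×
       (∀ v → G v v ≡ false → H v v ≡ false) × (∀ v → v ∈ vs → H v v ≡ false)
  go [] G = G , ε , (λ _ _ _ → refl) , (λ _ p → p) , λ _ ()
  go (v ∷ vs) G with true? (G v v)
  ... | inj₂ p with go vs G
  ...   | H , eq , off , keep , done = H , eq , off , keep , λ { w (here refl) → keep v p ; w (there m) → done w m }
  go (v ∷ vs) G | inj₁ p with go vs (loopComp v G)
  ... | H , eq , off , keep , done = H , ℓ-step v G ◅ eq , (λ i j ne → trans (off₁ i j ne) (off i j ne)) ,
          (λ w q → keep w (keep₁ w q)) , λ { w (here refl) → keep v here₁ ; w (there m) → done w m }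
    where
    here₁ : loopComp v G v v ≡ false
    here₁ rewrite eqB-refl v | p = refl
    off₁ : ∀ i j → i ≢ j → G i j ≡ loopComp v G i j
    off₁ i j ne with i ≟ v | j ≟ v
    ... | yes refl | yes refl = ⊥-elim (ne refl)
    ... | yes _ | no _ = sym (xor-identityʳ _)
    ... | no _ | _ = sym (xor-identityʳ _)
    keep₁ : ∀ w → G w w ≡ false → loopComp v G w w ≡ false
    keep₁ w q with w ≟ v
    ... | yes refl = clash p q
    ... | no _ = trans (xor-identityʳ _) q
... | H , eq , off , _ , done = H , eq , simple sy′ (λ v → done v (∈-allFin v)) , off
  where
  sy′ : IsGraph H
  sy′ i j with i ≟ j
  ... | yes refl = refl
  ... | no ne = trans (sym (off i j ne)) (trans (sy i j) (off j i (ne ∘ sym)))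

-- Graphs of order four, five and six

-- The strict upper triangle of the adjacency matrix, row by row. As finite data it encodes a
-- loopless graph in a form over which a check can be evaluated exhaustively.
Triangle : ℕ → Set
Triangle zero = Unit
Triangle (suc n) = Vec Bool n × Triangle n

toGraph : ∀ {n} → Triangle n → Graph n
toGraph {suc n} (r , t) zero zero = false
toGraph {suc n} (r , t) zero (suc j) = lookup r j
toGraph {suc n} (r , t) (suc i) zero = lookup r i
toGraph {suc n} (r , t) (suc i) (suc j) = toGraph t i j

fromGraph : ∀ {n} → Graph n → Triangle n
fromGraph {zero} G = tt
fromGraph {suc n} G = tabulate (λ j → G zero (suc j)) , fromGraph (deleteFirst G)

deleteFirst-simple : ∀ {n} {G : Graph (suc n)} → Simple G → Simple (deleteFirst G)
deleteFirst-simple (simple sy ll) = simple (λ i j → sy (suc i) (suc j)) (λ v → ll (suc v))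

toGraph-fromGraph : ∀ {n} {G : Graph n} → Simple G → ∀ i → toGraph (fromGraph G) i ≗ G i
toGraph-fromGraph {suc n} (simple sy ll) zero zero = sym (ll zero)
toGraph-fromGraph {suc n} {G} (simple sy ll) zero (suc j) = lookup∘tabulate (λ j → G zero (suc j)) j
toGraph-fromGraph {suc n} {G} (simple sy ll) (suc i) zero = trans (lookup∘tabulate (λ j → G zero (suc j)) i) (sy zero (suc i))
toGraph-fromGraph {suc n} s (suc i) (suc j) = toGraph-fromGraph (deleteFirst-simple s) i j

toGraph-simple : ∀ {n} (t : Triangle n) → Simple (toGraph t)
toGraph-simple {n} t = simple (sy t) (ll t)
  where
  sy : ∀ {n} (t : Triangle n) → IsGraph (toGraph t)
  sy {suc n} t zero zero = refl
  sy {suc n} t zero (suc j) = refl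
  sy {suc n} t (suc i) zero = refl
  sy {suc n} (r , t) (suc i) (suc j) = sy t i j
  ll : ∀ {n} (t : Triangle n) → Loopless (toGraph t)
  ll {suc n} t zero = refl
  ll {suc n} (r , t) (suc v) = ll t v

allTriangles : ∀ n → (Triangle n → Bool) → Bool
allTriangles zero f = f tt
allTriangles (suc n) f = allBool n (λ r → allTriangles n (λ t → f (r , t)))

allTriangles-elim : ∀ n f → allTriangles n f ≡ true → ∀ t → f t ≡ true
allTriangles-elim zero f h tt = h
allTriangles-elim (suc n) f h (r , t) = allTriangles-elim n (λ t → f (r , t)) (tautology n (λ r → allTriangles n (λ t → f (r , t))) h r) t

hasLightWord : ∀ {n} → Graph n → ℕ → Bool
hasLightWord {n} G w = any (λ Y → light (# (supp G (lookup Y)))) (subsets n)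
  where
  light : ℕ → Bool
  light k = (0 <ᵇ k) ∧ (k <ᵇ w)

hasLightWord-sound : ∀ {n} (G : Graph n) w → hasLightWord G w ≡ true → MinWeight G w → ⊥
hasLightWord-sound {n} G w h mw with any-witness _ (subsets n) h
... | Y , q = let p , r = ∧-split {0 <ᵇ # (supp G (lookup Y))} q
                  v , s = #-witness (supp G (lookup Y)) (<ᵇ⇒< 0 _ (Equivalence.from T-≡ p))
              in <⇒≱ (<ᵇ⇒< _ w (Equivalence.from T-≡ r)) (mw (lookup Y) v s)

minWeight-cong : ∀ {n w} {G H : Graph n} → (∀ i j → i ≢ j → G i j ≡ H i j) → MinWeight G w → MinWeight H w
minWeight-cong {G = G} {H} h = minWeight-supp G H (λ y → y , supp-offdiagonal G H h y)

localComplement-triangle : ∀ {n} → Fin n → Triangle n → Triangle n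
localComplement-triangle v t = fromGraph (simpleLC v (toGraph t))

localComplements-triangle : ∀ {n} → List (Fin n) → Triangle n → Triangle n
localComplements-triangle [] t = t
localComplements-triangle (v ∷ vs) t = localComplements-triangle vs (localComplement-triangle v t)

toGraph-localComplements : ∀ {n} vs (t : Triangle n) i → localComplements vs (toGraph t) i ≗ toGraph (localComplements-triangle vs t) i
toGraph-localComplements [] t i j = refl
toGraph-localComplements (v ∷ vs) t i j = trans
  (localComplements-cong vs (λ i j → sym (toGraph-fromGraph (simpleLC-simple v (toGraph-simple t)) i j)) i j)
  (toGraph-localComplements vs (localComplement-triangle v t) i j)

-- Without this, a graph with κ = n = 4 would fall under none of the five cases. After removal of
-- loops, 2⁶ graphs are checked by evaluation.
no-minWeight-3-on-4 : ∀ (G : Graph 4) → IsGraph G → MinWeight G 3 → ⊥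
no-minWeight-3-on-4 G sy mw with unloop G sy
... | H , _ , s , off = hasLightWord-sound (toGraph (fromGraph H)) 3 (allTriangles-elim 4 (λ t → hasLightWord (toGraph t) 3) refl (fromGraph H))
      (minWeight-cong (λ i j ne → trans (off i j ne) (sym (toGraph-fromGraph s i j))) mw)

xnor⇒≡ : ∀ {a b} → not (a xor b) ≡ true → a ≡ b
xnor⇒≡ {true} {true} _ = refl
xnor⇒≡ {false} {false} _ = refl

all² : ∀ {m n} → (Fin m → Fin n → Bool) → Bool
all² {m} {n} f = all (λ i → all (f i) (allFin n)) (allFin m)

all²-elim : ∀ {m n} (f : Fin m → Fin n → Bool) → all² f ≡ true → ∀ i j → f i j ≡ true
all²-elim {m} {n} f h i j = all-elim (f i) {allFin n} (all-elim (λ i → all (f i) (allFin n)) {allFin m} h (∈-allFin i)) (∈-allFin j)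

matchesAt : Graph 5 → Vec (Fin 5) 5 → Fin 5 → Fin 5 → Bool
matchesAt G p i j = not (G i j xor C5 (lookup p i) (lookup p j))

matches : Graph 5 → Vec (Fin 5) 5 → Bool
matches G p = all² (matchesAt G p)

-- The twelve labelled 5-cycles, as pairs of mutually inverse relabellings to and from C₅.
cycles : List (Vec (Fin 5) 5 × Vec (Fin 5) 5)
cycles =
  ((0F ∷ 1F ∷ 2F ∷ 3F ∷ 4F ∷ []) , (0F ∷ 1F ∷ 2F ∷ 3F ∷ 4F ∷ []))
  ∷ ((0F ∷ 1F ∷ 2F ∷ 4F ∷ 3F ∷ []) , (0F ∷ 1F ∷ 2F ∷ 4F ∷ 3F ∷ []))
  ∷ ((0F ∷ 1F ∷ 3F ∷ 2F ∷ 4F ∷ []) , (0F ∷ 1F ∷ 3F ∷ 2F ∷ 4F ∷ []))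
  ∷ ((0F ∷ 1F ∷ 3F ∷ 4F ∷ 2F ∷ []) , (0F ∷ 1F ∷ 4F ∷ 2F ∷ 3F ∷ []))
  ∷ ((0F ∷ 1F ∷ 4F ∷ 2F ∷ 3F ∷ []) , (0F ∷ 1F ∷ 3F ∷ 4F ∷ 2F ∷ []))
  ∷ ((0F ∷ 1F ∷ 4F ∷ 3F ∷ 2F ∷ []) , (0F ∷ 1F ∷ 4F ∷ 3F ∷ 2F ∷ []))
  ∷ ((0F ∷ 2F ∷ 1F ∷ 3F ∷ 4F ∷ []) , (0F ∷ 2F ∷ 1F ∷ 3F ∷ 4F ∷ []))
  ∷ ((0F ∷ 2F ∷ 1F ∷ 4F ∷ 3F ∷ []) , (0F ∷ 2F ∷ 1F ∷ 4F ∷ 3F ∷ []))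
  ∷ ((0F ∷ 2F ∷ 3F ∷ 1F ∷ 4F ∷ []) , (0F ∷ 3F ∷ 1F ∷ 2F ∷ 4F ∷ []))
  ∷ ((0F ∷ 2F ∷ 3F ∷ 4F ∷ 1F ∷ []) , (0F ∷ 4F ∷ 1F ∷ 2F ∷ 3F ∷ []))
  ∷ ((0F ∷ 2F ∷ 4F ∷ 1F ∷ 3F ∷ []) , (0F ∷ 3F ∷ 1F ∷ 4F ∷ 2F ∷ []))
  ∷ ((0F ∷ 2F ∷ 4F ∷ 3F ∷ 1F ∷ []) , (0F ∷ 4F ∷ 1F ∷ 3F ∷ 2F ∷ []))
  ∷ []

-- Besides mutual inverseness, the closed neighbourhoods are checked to have three vertices; the
-- degrees on the rim of the wheel come from this.
validAt : Vec (Fin 5) 5 × Vec (Fin 5) 5 → Fin 5 → Bool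
validAt (p , q) i = eqB (lookup p (lookup q i)) i ∧ eqB (lookup q (lookup p i)) i ∧
  (# (λ j → eqB i j ∨ C5 (lookup p i) (lookup p j)) ≡ᵇ 3)

validCycle : Vec (Fin 5) 5 × Vec (Fin 5) 5 → Bool
validCycle c = all (validAt c) (allFin 5)

-- Found by search: one of these sequences of local complementations takes each graph of minimum weight 3 to a 5-cycle.
sequences : List (List (Fin 5))
sequences = [] ∷ (0F ∷ []) ∷ (1F ∷ []) ∷ (2F ∷ []) ∷ (3F ∷ []) ∷ (4F ∷ []) ∷
  (0F ∷ 1F ∷ []) ∷ (0F ∷ 2F ∷ []) ∷ (0F ∷ 3F ∷ []) ∷ (0F ∷ 4F ∷ []) ∷
  (1F ∷ 2F ∷ []) ∷ (1F ∷ 3F ∷ []) ∷ (1F ∷ 4F ∷ []) ∷ []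

isCycle : Triangle 5 → Bool
isCycle t = any (λ c → matches (toGraph t) (proj₁ c)) cycles

reachesCycle : Triangle 5 → Bool
reachesCycle t = any (λ s → isCycle (localComplements-triangle s t)) sequences

abstract
  -- Evaluation over all 2¹⁰ loopless graphs on five vertices.
  light-or-reachesCycle : ∀ t → hasLightWord (toGraph t) 3 ∨ reachesCycle t ≡ true
  light-or-reachesCycle = allTriangles-elim 5 (λ t → hasLightWord (toGraph t) 3 ∨ reachesCycle t) refl

C5-normal-form : ∀ (G : Graph 5) → Simple G → MinWeight G 3 →
  ∃ λ s → Σ (Fin 5 ↔ Fin 5) λ σ → (∀ i j → localComplements s G i j ≡ C5 (Inverse.to σ i) (Inverse.to σ j)) ×
    (∀ i → # (λ j → eqB i j ∨ C5 (Inverse.to σ i) (Inverse.to σ j)) ≡ 3)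
C5-normal-form G simp mw = from-sequence (any-∈ (λ s → isCycle (localComplements-triangle s t)) sequences reaches)
  where
  t = fromGraph G
  t≗G = toGraph-fromGraph simp
  reaches : reachesCycle t ≡ true
  reaches with true? (hasLightWord (toGraph t) 3)
  ... | inj₁ p = ⊥-elim (hasLightWord-sound (toGraph t) 3 p (minWeight-cong (λ i j _ → sym (t≗G i j)) mw))
  ... | inj₂ p = trans (cong (_∨ reachesCycle t) (sym p)) (light-or-reachesCycle t)
  from-sequence : (∃ λ s → (s ∈ sequences) × (isCycle (localComplements-triangle s t) ≡ true)) → _
  from-sequence (s , _ , h) = from-cycle (any-∈ (λ c → matches (toGraph (localComplements-triangle s t)) (proj₁ c)) cycles h)
    where
    from-cycle : (∃ λ c → (c ∈ cycles) × (matches (toGraph (localComplements-triangle s t)) (proj₁ c) ≡ true)) → _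
    from-cycle ((p , q) , c∈ , m) = s , mk↔ₛ′ (lookup p) (lookup q) (λ i → eqB⇒≡ (proj₁ (valid i))) (λ i → eqB⇒≡ (proj₁ (proj₂ (valid i)))) ,
        (λ i j → trans (localComplements-cong s (λ i j → sym (t≗G i j)) i j) (trans (toGraph-localComplements s t i j)
          (xnor⇒≡ (all²-elim (matchesAt (toGraph (localComplements-triangle s t)) p) m i j)))) ,
        λ i → proj₂ (proj₂ (valid i))
      where
      valid : ∀ i → (eqB (lookup p (lookup q i)) i ≡ true) × (eqB (lookup q (lookup p i)) i ≡ true) ×
                    (# (λ j → eqB i j ∨ C5 (lookup p i) (lookup p j)) ≡ 3)
      valid i = let a , bc = ∧-split {eqB (lookup p (lookup q i)) i} (all-elim (validAt (p , q)) {allFin 5} (all-elim validCycle {cycles} refl c∈) (∈-allFin i))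
                    b , c = ∧-split {eqB (lookup q (lookup p i)) i} bc
                in a , b , ≡ᵇ⇒≡ _ 3 (Equivalence.from T-≡ c)

C5-equivalent : ∀ (G : Graph 5) → IsGraph G → MinWeight G 3 → ∃ λ H → LocallyEquivalent G H × Isomorphic H C5
C5-equivalent G sy mw =
  let G₁ , G~G₁ , simp , off = unloop G sy
      s , σ , iso , _ = C5-normal-form G₁ simp (minWeight-cong off mw)
  in localComplements s G₁ , G~G₁ ◅◅ localComplements-equivalent s G₁ , σ , iso

-- Local complementation at a vertex other than zero commutes with deleting zero, so a normal form
-- of the rest can be reached inside the whole graph.
deleteFirst-localComplements : ∀ {n} vs (G : Graph (suc n)) i → deleteFirst (localComplements (map suc vs) G) i ≗ localComplements vs (deleteFirst G) i
deleteFirst-localComplements [] G i j = refl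
deleteFirst-localComplements (v ∷ vs) G i j = trans (deleteFirst-localComplements vs (simpleLC (suc v) G) i j)
  (localComplements-cong vs same i j)
  where
  same : ∀ i → deleteFirst (simpleLC (suc v) G) i ≗ simpleLC v (deleteFirst G) i
  same i j rewrite eqB-suc i j | eqB-suc i v | eqB-suc j v = refl

module Wheel (H : Graph 6) (simp : Simple H) (σ : Fin 5 ↔ Fin 5)
  (rim : ∀ i j → H (suc i) (suc j) ≡ C5 (Inverse.to σ i) (Inverse.to σ j))
  (hub : ∀ i → H (suc i) zero ≡ true) where

  open Simple simp

  to₆ : Fin 6 → Fin 6
  -- The deleted vertex is zero in `H`, whereas the hub of `W5` has the last index.
  to₆ zero = 5F
  to₆ (suc i) = inject₁ (Inverse.to σ i)

  from₆ : Fin 6 → Fin 6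
  from₆ 0F = suc (Inverse.from σ 0F)
  from₆ 1F = suc (Inverse.from σ 1F)
  from₆ 2F = suc (Inverse.from σ 2F)
  from₆ 3F = suc (Inverse.from σ 3F)
  from₆ 4F = suc (Inverse.from σ 4F)
  from₆ 5F = zero

  from₆-inject₁ : ∀ k → from₆ (inject₁ k) ≡ suc (Inverse.from σ k)
  from₆-inject₁ 0F = refl
  from₆-inject₁ 1F = refl
  from₆-inject₁ 2F = refl
  from₆-inject₁ 3F = refl
  from₆-inject₁ 4F = refl

  to∘from : ∀ k → to₆ (from₆ k) ≡ k
  to∘from 0F = cong inject₁ (Inverse.strictlyInverseˡ σ 0F)
  to∘from 1F = cong inject₁ (Inverse.strictlyInverseˡ σ 1F)
  to∘from 2F = cong inject₁ (Inverse.strictlyInverseˡ σ 2F)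
  to∘from 3F = cong inject₁ (Inverse.strictlyInverseˡ σ 3F)
  to∘from 4F = cong inject₁ (Inverse.strictlyInverseˡ σ 4F)
  to∘from 5F = refl

  from∘to : ∀ k → from₆ (to₆ k) ≡ k
  from∘to zero = refl
  from∘to (suc i) = trans (from₆-inject₁ (Inverse.to σ i)) (cong suc (Inverse.strictlyInverseʳ σ i))

  W5-entries : ∀ a b → (W5 (inject₁ a) (inject₁ b) ≡ C5 a b) × (W5 5F (inject₁ b) ≡ true) × (W5 (inject₁ a) 5F ≡ true)
  W5-entries a b = let p , qr = ∧-split {not (W5 (inject₁ a) (inject₁ b) xor C5 a b)} (all²-elim check refl a b)
                       q , r = ∧-split {W5 5F (inject₁ b)} qr
                   in xnor⇒≡ p , q , r
    where
    check : Fin 5 → Fin 5 → Bool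
    check a b = not (W5 (inject₁ a) (inject₁ b) xor C5 a b) ∧ W5 5F (inject₁ b) ∧ W5 (inject₁ a) 5F

  isomorphic : Isomorphic H W5
  isomorphic = mk↔ₛ′ to₆ from₆ to∘from from∘to , entries
    where
    entries : ∀ i j → H i j ≡ W5 (to₆ i) (to₆ j)
    entries zero zero = loopless zero
    entries zero (suc j) = trans (symmetric zero (suc j)) (trans (hub j) (sym (proj₁ (proj₂ (W5-entries 0F (Inverse.to σ j))))))
    entries (suc i) zero = trans (hub i) (sym (proj₂ (proj₂ (W5-entries (Inverse.to σ i) 0F))))
    entries (suc i) (suc j) = trans (rim i j) (sym (proj₁ (W5-entries (Inverse.to σ i) (Inverse.to σ j))))

-- The sequence that turns G minus vertex zero into C₅ is applied to G itself. It preserves minimum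
-- weight 4, and a rim vertex, with only two neighbours on the rim, must then be adjacent to zero.
W5-equivalent : ∀ (G : Graph 6) → IsGraph G → MinWeight G 4 → ∃ λ H → LocallyEquivalent G H × Isomorphic H W5
W5-equivalent G sy mw =
  let G₁ , G~G₁ , simp , off = unloop G sy
      mw₁ = minWeight-cong off mw
      s , σ , iso , degree = C5-normal-form (deleteFirst G₁) (deleteFirst-simple simp) (minWeight-deleteFirst G₁ mw₁)
      H = localComplements (map suc s) G₁
      rim = λ i j → trans (deleteFirst-localComplements s G₁ i j) (iso i j)
  in H , G~G₁ ◅◅ localComplements-equivalent (map suc s) G₁ ,
     Wheel.isomorphic H (localComplements-simple (map suc s) simp) σ rim
       (hub H (localComplements-minWeight (map suc s) simp mw₁) σ rim degree)
  where
  -- The word of a single vertex has weight one more than its degree, so all degrees are at least 3.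
  hub : ∀ (H : Graph 6) → MinWeight H 4 → (σ : Fin 5 ↔ Fin 5) →
    (∀ i j → H (suc i) (suc j) ≡ C5 (Inverse.to σ i) (Inverse.to σ j)) →
    (∀ i → # (λ j → eqB i j ∨ C5 (Inverse.to σ i) (Inverse.to σ j)) ≡ 3) → ∀ i → H (suc i) zero ≡ true
  hub H mw σ rim degree i with true? (H (suc i) zero)
  ... | inj₁ p = p
  ... | inj₂ p = ⊥-elim (<-irrefl (sym weight) (mw (eqB (suc i)) (suc i) (supp-∈ H (eqB (suc i)) (suc i) (eqB-refl (suc i)))))
    where
    weight : # (supp H (eqB (suc i))) ≡ 3
    weight = trans (#-cong {g = λ w → eqB (suc i) w ∨ H (suc i) w} (λ w → cong (eqB (suc i) w ∨_) (•-δ H (suc i) w)))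
      (cong₂ _+_ (cong bit p) (trans (#-cong (λ j → cong₂ _∨_ (eqB-suc i j) (rim i j))) (degree i)))

-- The graphs with κ = n, and the five exclusive cases.

Heavy : ∀ {n} → Graph n → Set
Heavy {n} G = ∀ y v → supp G y v ≡ true → n < 2 * # (supp G y)

heavy-order≢4 : ∀ {n} (G : Graph n) → IsGraph G → Heavy G → n ≢ 4
heavy-order≢4 G sy heavy refl = no-minWeight-3-on-4 G sy (λ y v p → *-cancelˡ-< 2 2 _ (heavy y v p))

heavy-classification : ∀ {n} (G : Graph n) → IsGraph G → 5 ≤ n → Heavy G →
  ∃ λ H → LocallyEquivalent G H × (Isomorphic H C5 ⊎ Isomorphic H W5)
heavy-classification {5} G sy _ heavy =
  let H , G~H , iso = C5-equivalent G sy (λ y v p → *-cancelˡ-< 2 2 _ (≤-trans (m≤n⇒m≤1+n ≤-refl) (heavy y v p)))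
  in H , G~H , inj₁ iso
heavy-classification {6} G sy _ heavy =
  let H , G~H , iso = W5-equivalent G sy (λ y v p → *-cancelˡ-< 2 3 _ (heavy y v p))
  in H , G~H , inj₂ iso
heavy-classification {suc (suc (suc (suc (suc (suc (suc n))))))} G sy _ heavy =
  ⊥-elim (heavy-order<7 G sy (s≤s (s≤s (s≤s (s≤s (s≤s (s≤s (s≤s z≤n))))))) heavy)
heavy-classification {1} G sy (s≤s ()) heavy
heavy-classification {2} G sy (s≤s (s≤s ())) heavy
heavy-classification {3} G sy (s≤s (s≤s (s≤s ()))) heavy
heavy-classification {4} G sy (s≤s (s≤s (s≤s (s≤s ())))) heavy

-- Stated for an arbitrary number k so that κ is not unfolded during the case analysis.
module Cases {n} (G : Graph n) (k : ℕ) (k≤n : k ≤ n)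
  (connected-dec : Dec (Connected G))
  (disconnected : ¬ Connected G → k ≡ 1)
  (nonprime : 4 ≤ n → Connected G → Split G → k ≡ 3)
  (prime-small : 4 ≤ n → Prime G → k < n → Odd k × 5 ≤ k)
  (n≢4 : k ≡ n → n ≢ 4) where

  4≰3 : ∀ {m} → m ≤ 3 → 4 ≤ m → ⊥
  4≰3 p q = <-irrefl refl (≤-trans q p)

  4≤ : ∀ {m} → 5 ≤ m → 4 ≤ m
  4≤ = ≤-trans (m≤n⇒m≤1+n ≤-refl)

  5≰k : ∀ {j} → k ≡ j → j ≤ 3 → ¬ (5 ≤ k)
  5≰k refl j≤3 5≤k = 4≰3 j≤3 (4≤ 5≤k)

  -- `¬ Prime G` is only a doubly negated split; the double negation is discharged because equality
  -- of numbers is decidable.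
  nonprime′ : 4 ≤ n → Connected G → ¬ Prime G → k ≡ 3
  nonprime′ 4≤n con ¬prime = decidable-stable (k ≟ℕ 3) (λ k≢3 → ¬prime (λ s → k≢3 (nonprime 4≤n con s)))

  -- Primality is read off from k and not decided separately: when k < n, a prime graph has k ≥ 5,
  -- so k = 3 refutes primality, while k ≠ 3 refutes every split.
  exhaustive : (n ≤ 3 × Connected G) ⊎ (¬ Connected G) ⊎ (4 ≤ n × Connected G × ¬ Prime G) ⊎
               (5 ≤ n × Prime G × k < n) ⊎ (5 ≤ n × k ≡ n)
  exhaustive = decide connected-dec (n ≤? 3) (k ≟ℕ n) (k ≟ℕ 3)
    where
    decide : Dec (Connected G) → Dec (n ≤ 3) → Dec (k ≡ n) → Dec (k ≡ 3) → _
    decide (no ¬con) _ _ _ = inj₂ (inj₁ ¬con)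
    decide (yes con) (yes n≤3) _ _ = inj₁ (n≤3 , con)
    decide (yes con) (no n≰3) (yes k≡n) _ = inj₂ (inj₂ (inj₂ (inj₂ (≤∧≢⇒< (≰⇒> n≰3) (n≢4 k≡n ∘ sym) , k≡n))))
    decide (yes con) (no n≰3) (no k≢n) (yes k≡3) = inj₂ (inj₂ (inj₁ (≰⇒> n≰3 , con , λ prime →
      5≰k k≡3 ≤-refl (proj₂ (prime-small (≰⇒> n≰3) prime (≤∧≢⇒< k≤n k≢n))))))
    decide (yes con) (no n≰3) (no k≢n) (no k≢3) = inj₂ (inj₂ (inj₂ (inj₁ (5≤n , prime , k<n))))
      where
      prime : Prime G
      prime s = k≢3 (nonprime (≰⇒> n≰3) con s)
      k<n = ≤∧≢⇒< k≤n k≢n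
      5≤n = ≤-trans (proj₂ (prime-small (≰⇒> n≰3) prime k<n)) k≤n

  exactly-one : ExactlyOneOf5 (n ≤ 3 × Connected G) (¬ Connected G) (4 ≤ n × Connected G × ¬ Prime G)
                              (5 ≤ n × Prime G × k < n) (5 ≤ n × k ≡ n)
  exactly-one = exhaustive ,
    (λ { ((_ , con) , ¬con) → ¬con con }) ,
    (λ { ((n≤3 , _) , (4≤n , _)) → 4≰3 n≤3 4≤n }) ,
    (λ { ((n≤3 , _) , (5≤n , _)) → 4≰3 n≤3 (4≤ 5≤n) }) ,
    (λ { ((n≤3 , _) , (5≤n , _)) → 4≰3 n≤3 (4≤ 5≤n) }) ,
    (λ { (¬con , (_ , con , _)) → ¬con con }) ,
    (λ { (¬con , (5≤n , prime , k<n)) → 5≰k (disconnected ¬con) (s≤s z≤n) (proj₂ (prime-small (4≤ 5≤n) prime k<n)) }) ,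
    (λ { (¬con , (5≤n , k≡n)) → 5≰k (disconnected ¬con) (s≤s z≤n) (≤-trans 5≤n (≤-reflexive (sym k≡n))) }) ,
    (λ { ((_ , _ , ¬prime) , (_ , prime , _)) → ¬prime prime }) ,
    (λ { ((4≤n , con , ¬prime) , (5≤n , k≡n)) → 5≰k (nonprime′ 4≤n con ¬prime) ≤-refl (≤-trans 5≤n (≤-reflexive (sym k≡n))) }) ,
    (λ { ((_ , _ , k<n) , (_ , k≡n)) → <-irrefl k≡n k<n })

connected? : ∀ {n} (G : Graph n) → IsGraph G → Dec (Connected G)
connected? G sy with connected-or-separated G sy
... | inj₁ con = yes con
... | inj₂ (X , p , q , sep) = no λ con →
        <-irrefl (sym (separated⇒cutrank0 G X sep)) (connected⇒cutrank>0 G sy con X p q)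

theorem3 : (n : ℕ) (G : Graph n) → IsGraph G →
    (n ≤ 3 → Connected G → κ (IAS G) ≡ n)
    × (¬ Connected G → κ (IAS G) ≡ 1)
    × (4 ≤ n → Connected G → ¬ Prime G → κ (IAS G) ≡ 3)
    × (5 ≤ n → Prime G → κ (IAS G) < n → Odd (κ (IAS G)) × 5 ≤ κ (IAS G))
    × (5 ≤ n → κ (IAS G) ≡ n →
    ∃ λ H → LocallyEquivalent G H × (Isomorphic H C5 ⊎ Isomorphic H W5))
    × ExactlyOneOf5
    (n ≤ 3 × Connected G)
    (¬ Connected G)
    (4 ≤ n × Connected G × ¬ Prime G)
    (5 ≤ n × Prime G × κ (IAS G) < n)
    (5 ≤ n × κ (IAS G) ≡ n)
theorem3 n G sy =
    connected-small⇒κ≡n G sy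
  , disconnected⇒κ≡1 G sy
  , nonprime′
  , (λ 5≤n → prime-κ<n G sy (≤-trans (m≤n⇒m≤1+n ≤-refl) 5≤n))
  , (λ 5≤n κ≡n → heavy-classification G sy 5≤n (κ≡n⇒weight G sy κ≡n))
  , exactly-one
  where
  open Cases G (κ (IAS G)) (κ≤n G) (connected? G sy) (disconnected⇒κ≡1 G sy) (split⇒κ≡3 G sy)
    (prime-κ<n G sy) (λ κ≡n → heavy-order≢4 G sy (κ≡n⇒weight G sy κ≡n))
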